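{- Let $\lambda$ be a nonzero real number. For any integer $p\ge1$, \[ \sum_{k=1}^{\infty}\frac{H_{k,\lambda}^{(p)}}{k(k+1)}=\zeta_{\lambda}(p+1), \] and \[ \sum_{k=1}^{\infty}\frac{H_{k,\lambda}^{(p)}}{k(k+2)}=\frac{1}{2}\bigg(\zeta_{\lambda}(p+1)+\sum_{k=2}^{p}(-1)^{k}\zeta_{\lambda}(p+2-k)+\frac{(-1)^{p+1}}{\lambda+1}\bigg), \] i.e. $\frac12\big(\zeta_{\lambda}(p+1)+\zeta_{\lambda}(p)-\zeta_{\lambda}(p-1)+\cdots+(-1)^{p}\zeta_{\lambda}(2)+\frac{(-1)^{p+1}}{\lambda+1}\big)$.
   Context: For real $x$ and $\mu\neq 0$, set $(x)_{0,\mu}=1$ and $(x)_{n,\mu}=x(x-\mu)\cdots(x-(n-1)\mu)$ for $n\ge1$. The degenerate zeta function is $\zeta_{\lambda}(s)=\sum_{n=1}^{\infty}\frac{(-1)^{n-1}\lambda^{n-1}(1)_{n,1/\lambda}}{(n-1)!\,n^{s}}$ for $\mathrm{Re}(s)>1$. The degenerate higher-order harmonic numbers are $H_{0,\lambda}^{(k)}=0$ and $H_{n,\lambda}^{(k)}=\sum_{l=1}^{n}\frac{(-\lambda)^{l-1}(1)_{l,1/\lambda}}{l^{k}(l-1)!}$ for $n\ge1$.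
   Formalization: Each identity is stated under the condition that the series for the zeta values on its right converge (proved for λ > 1 − s), and λ ≠ −1 in the second; for other λ, e.g. λ = −2, p = 1, the zeta series diverges and the claim is undefined. -}

module Defs where

open import Algebra.Bundles.Raw using (RawRing)
import Algebra.Definitions.RawSemiring as RawSemiringDefs
open import Data.Integer.Base using (+_)
open import Data.Nat.Base as ℕ using (ℕ; zero; suc; NonZero; _≥_; _∸_; _!)
import Data.Nat.Properties as ℕ
open import Data.Product.Base using (∃-syntax; _×_; _,_)
open import Data.Rational.Base as ℚ using (ℚ; 0ℚ; 1ℚ; ½; ∣_∣)
import Data.Rational.Properties as ℚ
open import Data.Rational.Solver using (module +-*-Solver)
open import Data.Sum.Base using (_⊎_; inj₁; inj₂)
open import Level using (0ℓ)
open import Relation.Binary.PropositionalEquality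
  using (_≡_; refl; sym; trans; cong; cong₂; subst)
open import Relation.Nullary.Decidable.Core using (yes; no)
open import Relation.Nullary.Negation.Core using (contradiction)

------------------------------------------------------------------------
-- Real numbers as Cauchy sequences of rationals

IsCauchy : (ℕ → ℚ) → Set
IsCauchy x = ∀ ε → 0ℚ ℚ.< ε →
  ∃[ N ] (∀ m n → m ≥ N → n ≥ N → ∣ x m ℚ.- x n ∣ ℚ.< ε)

record ℝ : Set where
  constructor mkℝ
  field
    seq    : ℕ → ℚ
    cauchy : IsCauchy seq

open ℝ public

infix 4 _≃_ _<_ _#_

_≃_ : ℝ → ℝ → Set
x ≃ y = ∀ ε → 0ℚ ℚ.< ε →
  ∃[ N ] (∀ n → n ≥ N → ∣ seq x n ℚ.- seq y n ∣ ℚ.< ε)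

_<_ : ℝ → ℝ → Set
x < y = ∃[ ε ] (0ℚ ℚ.< ε) ×
  (∃[ N ] (∀ n → n ≥ N → seq x n ℚ.+ ε ℚ.< seq y n))

-- Apartness: the constructive form of x ≠ y, and what division requires.
_#_ : ℝ → ℝ → Set
x # y = x < y ⊎ y < x

private
  half : ∀ {ε} → 0ℚ ℚ.< ε → 0ℚ ℚ.< ½ ℚ.* ε
  half {ε} 0<ε = subst (ℚ._< ½ ℚ.* ε) (ℚ.*-zeroʳ ½) (ℚ.*-monoʳ-<-pos ½ 0<ε)

  halves : ∀ ε → ½ ℚ.* ε ℚ.+ ½ ℚ.* ε ≡ ε
  halves ε = trans (sym (ℚ.*-distribʳ-+ ε ½ ½)) (ℚ.*-identityˡ ε)

  1/-pos : ∀ {p} (0<p : 0ℚ ℚ.< p) → 0ℚ ℚ.< (ℚ.1/ p) {{ℚ.>-nonZero 0<p}}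
  1/-pos {p} 0<p = ℚ.positive⁻¹ _ {{ℚ.1/pos⇒pos p {{ℚ.positive 0<p}}}}

  scale : ∀ {ε A} → 0ℚ ℚ.< ε → 0ℚ ℚ.< A →
          ∃[ δ ] (0ℚ ℚ.< δ) × (δ ℚ.* A ≡ ε)
  scale {ε} {A} 0<ε 0<A = ε ℚ.* A⁻¹ , 0<δ ,
    trans (ℚ.*-assoc ε A⁻¹ A)
      (trans (cong (ε ℚ.*_) (ℚ.*-inverseˡ A {{ℚ.>-nonZero 0<A}})) (ℚ.*-identityʳ ε))
    where
    A⁻¹ = (ℚ.1/ A) {{ℚ.>-nonZero 0<A}}
    0<δ = subst (ℚ._< ε ℚ.* A⁻¹) (ℚ.*-zeroʳ ε)
            (ℚ.*-monoʳ-<-pos ε {{ℚ.positive 0<ε}} (1/-pos 0<A))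

  product-< : ∀ {p q δ A} → ∣ p ∣ ℚ.< δ → ∣ q ∣ ℚ.≤ A → 0ℚ ℚ.< A →
              ∣ p ℚ.* q ∣ ℚ.< δ ℚ.* A
  product-< {p} {q} {δ} {A} p<δ q≤A 0<A = begin-strict
    ∣ p ℚ.* q ∣       ≡⟨ ℚ.∣p*q∣≡∣p∣*∣q∣ p q ⟩
    ∣ p ∣ ℚ.* ∣ q ∣   ≤⟨ ℚ.*-monoˡ-≤-nonNeg ∣ p ∣ {{ℚ.∣-∣-nonNeg p}} q≤A ⟩
    ∣ p ∣ ℚ.* A       <⟨ ℚ.*-monoˡ-<-pos A {{ℚ.positive 0<A}} p<δ ⟩
    δ ℚ.* A           ∎
    where open ℚ.≤-Reasoning

  sum-< : ∀ {p q ε} → ∣ p ∣ ℚ.< ½ ℚ.* ε → ∣ q ∣ ℚ.< ½ ℚ.* ε → ∣ p ℚ.+ q ∣ ℚ.< ε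
  sum-< {p} {q} {ε} p< q< = begin-strict
    ∣ p ℚ.+ q ∣             ≤⟨ ℚ.∣p+q∣≤∣p∣+∣q∣ p q ⟩
    ∣ p ∣ ℚ.+ ∣ q ∣         <⟨ ℚ.+-mono-< p< q< ⟩
    ½ ℚ.* ε ℚ.+ ½ ℚ.* ε     ≡⟨ halves ε ⟩
    ε                       ∎
    where open ℚ.≤-Reasoning

  bounded : ∀ {x} → IsCauchy x →
            ∃[ A ] (0ℚ ℚ.< A) × (∃[ N ] (∀ n → n ≥ N → ∣ x n ∣ ℚ.≤ A))
  bounded {x} cx with cx 1ℚ (ℚ.positive⁻¹ 1ℚ)
  ... | N , close = 1ℚ ℚ.+ ∣ x N ∣ , 0<A , N , λ n n≥N → begin
      ∣ x n ∣                          ≡⟨ cong ∣_∣ (split (x n) (x N)) ⟩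
      ∣ (x n ℚ.- x N) ℚ.+ x N ∣        ≤⟨ ℚ.∣p+q∣≤∣p∣+∣q∣ (x n ℚ.- x N) (x N) ⟩
      ∣ x n ℚ.- x N ∣ ℚ.+ ∣ x N ∣      ≤⟨ ℚ.+-monoˡ-≤ ∣ x N ∣ (ℚ.<⇒≤ (close n N n≥N ℕ.≤-refl)) ⟩
      1ℚ ℚ.+ ∣ x N ∣                   ∎
    where
    open ℚ.≤-Reasoning
    0<A : 0ℚ ℚ.< 1ℚ ℚ.+ ∣ x N ∣
    0<A = ℚ.+-mono-<-≤ (ℚ.positive⁻¹ 1ℚ) (ℚ.0≤∣p∣ (x N))
    split : ∀ a b → a ≡ (a ℚ.- b) ℚ.+ b
    split = solve 2 (λ a b → a := (a :- b) :+ b) refl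
      where open +-*-Solver

infixl 6 _+_ _-_
infixl 7 _*_ _/ℕ_
infix  8 -_

fromℚ : ℚ → ℝ
fromℚ q = mkℝ (λ _ → q) λ ε 0<ε → 0 , λ _ _ _ _ →
  subst (ℚ._< ε) (sym (cong ∣_∣ (ℚ.+-inverseʳ q))) 0<ε

_+_ : ℝ → ℝ → ℝ
mkℝ x cx + mkℝ y cy = mkℝ (λ n → x n ℚ.+ y n) λ ε 0<ε →
  let M , x-close = cx (½ ℚ.* ε) (half 0<ε)
      N , y-close = cy (½ ℚ.* ε) (half 0<ε)
  in M ℕ.⊔ N , λ m n m≥ n≥ →
    subst (λ d → ∣ d ∣ ℚ.< ε) (swap (x m) (x n) (y m) (y n))
      (sum-< (x-close m n (ℕ.m⊔n≤o⇒m≤o M N m≥) (ℕ.m⊔n≤o⇒m≤o M N n≥))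
             (y-close m n (ℕ.m⊔n≤o⇒n≤o M N m≥) (ℕ.m⊔n≤o⇒n≤o M N n≥)))
  where
  swap : ∀ a b c d → (a ℚ.- b) ℚ.+ (c ℚ.- d) ≡ (a ℚ.+ c) ℚ.- (b ℚ.+ d)
  swap = solve 4 (λ a b c d → (a :- b) :+ (c :- d) := (a :+ c) :- (b :+ d)) refl
    where open +-*-Solver

_*_ : ℝ → ℝ → ℝ
mkℝ x cx * mkℝ y cy = mkℝ (λ n → x n ℚ.* y n) λ ε 0<ε →
  let A , 0<A , K , x≤A = bounded cx
      B , 0<B , L , y≤B = bounded cy
      δ , 0<δ , δB≡ = scale (half 0<ε) 0<B
      η , 0<η , ηA≡ = scale (half 0<ε) 0<A
      M , x-close = cx δ 0<δ
      N , y-close = cy η 0<η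
  in (K ℕ.⊔ L) ℕ.⊔ (M ℕ.⊔ N) , λ m n m≥ n≥ →
    let n≥KL = ℕ.m⊔n≤o⇒m≤o (K ℕ.⊔ L) (M ℕ.⊔ N) n≥
        m≥KL = ℕ.m⊔n≤o⇒m≤o (K ℕ.⊔ L) (M ℕ.⊔ N) m≥
        m≥MN = ℕ.m⊔n≤o⇒n≤o (K ℕ.⊔ L) (M ℕ.⊔ N) m≥
        n≥MN = ℕ.m⊔n≤o⇒n≤o (K ℕ.⊔ L) (M ℕ.⊔ N) n≥
    in subst (λ d → ∣ d ∣ ℚ.< ε) (split (x m) (x n) (y m) (y n))
      (sum-<
        (subst (∣ (x m ℚ.- x n) ℚ.* y n ∣ ℚ.<_) δB≡
          (product-<
            (x-close m n (ℕ.m⊔n≤o⇒m≤o M N m≥MN) (ℕ.m⊔n≤o⇒m≤o M N n≥MN))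
            (y≤B n (ℕ.m⊔n≤o⇒n≤o K L n≥KL)) 0<B))
        (subst (∣ (y m ℚ.- y n) ℚ.* x m ∣ ℚ.<_) ηA≡
          (product-<
            (y-close m n (ℕ.m⊔n≤o⇒n≤o M N m≥MN) (ℕ.m⊔n≤o⇒n≤o M N n≥MN))
            (x≤A m (ℕ.m⊔n≤o⇒m≤o K L m≥KL)) 0<A)))
  where
  split : ∀ a b c d → (a ℚ.- b) ℚ.* d ℚ.+ (c ℚ.- d) ℚ.* a ≡ a ℚ.* c ℚ.- b ℚ.* d
  split = solve 4
    (λ a b c d → (a :- b) :* d :+ (c :- d) :* a := a :* c :- b :* d) refl
    where open +-*-Solver

-_ : ℝ → ℝ
- mkℝ x cx = mkℝ (λ n → ℚ.- x n) λ ε 0<ε →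
  let N , close = cx ε 0<ε
  in N , λ m n m≥N n≥N →
    subst (λ d → ∣ d ∣ ℚ.< ε) (flip (x m) (x n)) (close n m n≥N m≥N)
  where
  flip : ∀ a b → b ℚ.- a ≡ (ℚ.- a) ℚ.- (ℚ.- b)
  flip = solve 2 (λ a b → b :- a := (:- a) :- (:- b)) refl
    where open +-*-Solver

_-_ : ℝ → ℝ → ℝ
x - y = x + (- y)

0ℝ 1ℝ : ℝ
0ℝ = fromℚ 0ℚ
1ℝ = fromℚ 1ℚ

fromℕ : ℕ → ℝ
fromℕ n = fromℚ (+ n ℚ./ 1)

_/ℕ_ : ℝ → (n : ℕ) → .{{NonZero n}} → ℝ
x /ℕ n = x * fromℚ (+ 1 ℚ./ n)

ℝ-rawRing : RawRing 0ℓ 0ℓ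
ℝ-rawRing = record
  { Carrier = ℝ ; _≈_ = _≃_ ; _+_ = _+_ ; _*_ = _*_ ; -_ = -_ ; 0# = 0ℝ ; 1# = 1ℝ }

open RawSemiringDefs (RawRing.rawSemiring ℝ-rawRing) public using (_^_)

-- The reciprocal with value 0 at 0.  A sequence representing a real apart
-- from 0 vanishes at only finitely many indices, so the value there is
-- immaterial.
recip : ℚ → ℚ
recip q with q ℚ.≟ 0ℚ
... | yes _  = 0ℚ
... | no q≢0 = (ℚ.1/ q) {{ℚ.≢-nonZero q≢0}}

private
  p≤∣p∣ : ∀ p → p ℚ.≤ ∣ p ∣
  p≤∣p∣ p with ℚ.≤-total 0ℚ p
  ... | inj₁ 0≤p = ℚ.≤-reflexive (sym (ℚ.0≤p⇒∣p∣≡p 0≤p))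
  ... | inj₂ p≤0 = ℚ.≤-trans p≤0 (ℚ.0≤∣p∣ p)

  recip-inverseʳ : ∀ q → 0ℚ ℚ.< ∣ q ∣ → q ℚ.* recip q ≡ 1ℚ
  recip-inverseʳ q 0<∣q∣ with q ℚ.≟ 0ℚ
  ... | yes q≡0 = contradiction (sym (cong ∣_∣ q≡0)) (ℚ.<⇒≢ 0<∣q∣)
  ... | no q≢0  = ℚ.*-inverseʳ q {{ℚ.≢-nonZero q≢0}}

  away : ∀ {x} → x # 0ℝ →
         ∃[ δ ] (0ℚ ℚ.< δ) × (∃[ N ] (∀ n → n ≥ N → δ ℚ.< ∣ seq x n ∣))
  away {x} (inj₁ (δ , 0<δ , N , x<0)) = δ , 0<δ , N , λ n n≥N → begin-strict
    δ                                ≡⟨ shift δ (seq x n) ⟩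
    (seq x n ℚ.+ δ) ℚ.- seq x n      <⟨ ℚ.+-monoˡ-< (ℚ.- seq x n) (x<0 n n≥N) ⟩
    0ℚ ℚ.- seq x n                   ≡⟨ ℚ.+-identityˡ _ ⟩
    ℚ.- seq x n                      ≤⟨ p≤∣p∣ (ℚ.- seq x n) ⟩
    ∣ ℚ.- seq x n ∣                  ≡⟨ ℚ.∣-p∣≡∣p∣ (seq x n) ⟩
    ∣ seq x n ∣                      ∎
    where
    open ℚ.≤-Reasoning
    shift : ∀ a b → a ≡ (b ℚ.+ a) ℚ.- b
    shift = solve 2 (λ a b → a := (b :+ a) :- b) refl
      where open +-*-Solver
  away {x} (inj₂ (δ , 0<δ , N , 0<x)) = δ , 0<δ , N , λ n n≥N →
    ℚ.<-≤-trans (subst (ℚ._< seq x n) (ℚ.+-identityˡ δ) (0<x n n≥N))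
                (p≤∣p∣ (seq x n))

  difference : ∀ a b → 0ℚ ℚ.< ∣ a ∣ → 0ℚ ℚ.< ∣ b ∣ →
    ((b ℚ.- a) ℚ.* recip a) ℚ.* recip b ≡ recip a ℚ.- recip b
  difference a b 0<a 0<b = trans
    (expand a b (recip a) (recip b))
    (trans (cong₂ (λ u v → recip a ℚ.* u ℚ.- recip b ℚ.* v)
                  (recip-inverseʳ b 0<b) (recip-inverseʳ a 0<a))
           (cong₂ ℚ._-_ (ℚ.*-identityʳ (recip a)) (ℚ.*-identityʳ (recip b))))
    where
    expand : ∀ a b r s →
      ((b ℚ.- a) ℚ.* r) ℚ.* s ≡ r ℚ.* (b ℚ.* s) ℚ.- s ℚ.* (a ℚ.* r)
    expand = solve 4 (λ a b r s →
      ((b :- a) :* r) :* s := r :* (b :* s) :- s :* (a :* r)) refl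
      where open +-*-Solver

  recip≤ : ∀ δ D q → 0ℚ ℚ.< δ → 0ℚ ℚ.< D → D ℚ.* δ ≡ 1ℚ → δ ℚ.< ∣ q ∣ →
           ∣ recip q ∣ ℚ.≤ D
  recip≤ δ D q 0<δ 0<D Dδ≡1 δ<q = begin
    ∣ recip q ∣                         ≡⟨ ℚ.*-identityˡ _ ⟨
    1ℚ ℚ.* ∣ recip q ∣                  ≡⟨ cong (ℚ._* ∣ recip q ∣) Dδ≡1 ⟨
    (D ℚ.* δ) ℚ.* ∣ recip q ∣           ≤⟨ ℚ.*-monoʳ-≤-nonNeg ∣ recip q ∣ {{ℚ.∣-∣-nonNeg (recip q)}}
                                             (ℚ.*-monoˡ-≤-nonNeg D {{ℚ.pos⇒nonNeg D {{ℚ.positive 0<D}}}} (ℚ.<⇒≤ δ<q)) ⟩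
    (D ℚ.* ∣ q ∣) ℚ.* ∣ recip q ∣       ≡⟨ ℚ.*-assoc D ∣ q ∣ ∣ recip q ∣ ⟩
    D ℚ.* (∣ q ∣ ℚ.* ∣ recip q ∣)       ≡⟨ cong (D ℚ.*_) (ℚ.∣p*q∣≡∣p∣*∣q∣ q (recip q)) ⟨
    D ℚ.* ∣ q ℚ.* recip q ∣             ≡⟨ cong (λ r → D ℚ.* ∣ r ∣) (recip-inverseʳ q (ℚ.<-trans 0<δ δ<q)) ⟩
    D ℚ.* 1ℚ                            ≡⟨ ℚ.*-identityʳ D ⟩
    D                                   ∎
    where open ℚ.≤-Reasoning

  recip-close : ∀ {η η₁ ε δ D} → 0ℚ ℚ.< δ → 0ℚ ℚ.< D → D ℚ.* δ ≡ 1ℚ →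
    η₁ ℚ.* D ≡ ε → η ℚ.* D ≡ η₁ → ∀ a b → δ ℚ.< ∣ a ∣ → δ ℚ.< ∣ b ∣ →
    ∣ b ℚ.- a ∣ ℚ.< η → ∣ recip a ℚ.- recip b ∣ ℚ.< ε
  recip-close {δ = δ} {D} 0<δ 0<D Dδ≡1 refl refl a b δ<a δ<b close =
    subst (λ d → ∣ d ∣ ℚ.< _)
      (difference a b (ℚ.<-trans 0<δ δ<a) (ℚ.<-trans 0<δ δ<b))
      (product-< {(b ℚ.- a) ℚ.* recip a} {recip b}
        (product-< {b ℚ.- a} {recip a} close (recip≤ δ D a 0<δ 0<D Dδ≡1 δ<a) 0<D)
        (recip≤ δ D b 0<δ 0<D Dδ≡1 δ<b) 0<D)

  recip-cauchy : ∀ x → x # 0ℝ → IsCauchy (λ n → recip (seq x n))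
  recip-cauchy x x#0 ε 0<ε with away {x} x#0
  ... | δ , 0<δ , K , δ<x with scale (ℚ.positive⁻¹ 1ℚ) 0<δ
  ... | D , 0<D , Dδ≡1 with scale 0<ε 0<D
  ... | η₁ , 0<η₁ , η₁D≡ε with scale 0<η₁ 0<D
  ... | η , 0<η , ηD≡η₁ with cauchy x η 0<η
  ... | N , close = K ℕ.⊔ N , λ m n m≥ n≥ →
    recip-close 0<δ 0<D Dδ≡1 η₁D≡ε ηD≡η₁ (seq x m) (seq x n)
      (δ<x m (ℕ.m⊔n≤o⇒m≤o K N m≥)) (δ<x n (ℕ.m⊔n≤o⇒m≤o K N n≥))
      (close n m (ℕ.m⊔n≤o⇒n≤o K N n≥) (ℕ.m⊔n≤o⇒n≤o K N m≥))

inv : (x : ℝ) → x # 0ℝ → ℝ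
inv x x#0 = mkℝ (λ n → recip (seq x n)) (recip-cauchy x x#0)

------------------------------------------------------------------------
-- Sums and series, indexed from a positive integer

∑< : ℕ → (ℕ → ℝ) → ℝ
∑< zero    f = 0ℝ
∑< (suc n) f = ∑< n f + f n

-- Σ_{k=a}^{b} f(k), empty when b < a
∑[_⋯_] : (a b : ℕ) → .{{NonZero a}} → ((k : ℕ) → .{{NonZero k}} → ℝ) → ℝ
∑[ a@(suc _) ⋯ b ] f = ∑< (suc b ∸ a) (λ i → f (a ℕ.+ i))

infix 4 _⟶_

_⟶_ : (ℕ → ℝ) → ℝ → Set
f ⟶ z = ∀ ε → 0ℚ ℚ.< ε →
  ∃[ N ] (∀ n → n ≥ N → (z - fromℚ ε < f n) × (f n < z + fromℚ ε))

-- Σ_{k=1}^{∞} f(k) converges to z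
HasSum : ((k : ℕ) → .{{NonZero k}} → ℝ) → ℝ → Set
HasSum f z = (λ n → ∑[ 1 ⋯ n ] f) ⟶ z

------------------------------------------------------------------------
-- Degenerate zeta function and harmonic numbers

-- (x)_{n,μ} = x(x-μ)⋯(x-(n-1)μ)
falling : ℝ → ℕ → ℝ → ℝ
falling x zero    μ = 1ℝ
falling x (suc n) μ = falling x n μ * (x - fromℕ n * μ)

module _ (lam : ℝ) (lam#0 : lam # 0ℝ) where

  ζ-term : ℕ → (n : ℕ) → .{{NonZero n}} → ℝ
  ζ-term s n =
    ((- 1ℝ) ^ (n ∸ 1) * lam ^ (n ∸ 1) * falling 1ℝ n (inv lam lam#0))
      /ℕ ((n ∸ 1) ! ℕ.* n ℕ.^ s)
    where instance
      denominator≢0 : NonZero ((n ∸ 1) ! ℕ.* n ℕ.^ s)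
      denominator≢0 = ℕ.m*n≢0 _ _ {{(n ∸ 1) ℕ.!≢0}} {{ℕ.m^n≢0 n s}}

  -- The series defining ζ_λ(s) converges, and z is its sum.
  IsZeta : ℕ → ℝ → Set
  IsZeta s z = HasSum (ζ-term s) z

  H-term : ℕ → (l : ℕ) → .{{NonZero l}} → ℝ
  H-term k l =
    ((- lam) ^ (l ∸ 1) * falling 1ℝ l (inv lam lam#0))
      /ℕ (l ℕ.^ k ℕ.* (l ∸ 1) !)
    where instance
      denominator≢0 : NonZero (l ℕ.^ k ℕ.* (l ∸ 1) !)
      denominator≢0 = ℕ.m*n≢0 _ _ {{ℕ.m^n≢0 l k}} {{(l ∸ 1) ℕ.!≢0}}

  -- H k n is the harmonic number of order k and index n.
  H : ℕ → ℕ → ℝ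
  H k n = ∑[ 1 ⋯ n ] (H-term k)

{-# OPTIONS --safe #-}

-- A real is a Cauchy sequence of rationals, so all identities and estimates
-- are proved for a rational parameter q, uniformly in q where a limit is
-- taken, and then applied to the terms of the sequence representing λ.
--
-- The numerators are aₗ = ∏_{0<j<l} (1 - λ/j), i.e. aₗ₊₁ = aₗ (1 - λ/l).
--
-- Convergence for σ = s + λ - 1 > 0: the majorant bₗ = |aₗ| / lˢ⁻¹ satisfies
-- bₗ₊₁ (1 + σ/2l) ≤ bₗ for large l.  Hence |aₗ₊₁| / (l+1)ˢ ≤ (2/σ) (bₗ - bₗ₊₁),
-- which telescopes, and b → 0 because the harmonic series diverges.
--
-- Sums: partial fractions and telescoping give
--   Σ_{k≤n} Hₖ/(k(k+1)) = Σ_{l≤n} aₗ/lᵖ⁺¹ - Hₙ/(n+1),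
-- and Hₙ/n → 0 by Kronecker's lemma.  The second sum leads likewise to
-- Tₚ = Σ aₗ/(lᵖ(l+1)), with Tₚ₊₁ = ζ(p+1) - Tₚ and
--   (λ+1) Σ_{l≤n} aₗ/(l(l+1)) = 1 - aₙ₊₁/(n+1).
-- Here aₙ₊₁ = 1 - λ Hₙ⁽¹⁾, so Kronecker's lemma also yields T₁ = 1/(λ+1).

module Submission where

open import Data.Nat.Base as ℕ using (ℕ; zero; suc; _∸_; _!; NonZero)
open import Data.Nat.Properties as ℕ using (m*n≢0)
open import Data.Product.Base using (∃-syntax; _×_; _,_)
open import Data.Rational.Base as ℚ using (ℚ; 0ℚ; 1ℚ; ½; ∣_∣)
import Data.Rational.Properties as ℚ
open import Data.Rational.Solver using (module +-*-Solver)
open import Data.Integer.Base using (+_)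
open import Data.Sum.Base using (inj₁; inj₂)
open import Relation.Binary.PropositionalEquality
  using (_≡_; _≢_; refl; sym; trans; cong; cong₂; subst; subst₂)
open import Relation.Nullary.Decidable.Core using (yes; no)
open import Relation.Nullary.Negation.Core using (contradiction)

-- Rational arithmetic and order

module Rational where

  open import Algebra.Bundles using (CommutativeRing)
  open import Data.Integer.Base as ℤ using (+_)
  import Data.Integer.Properties as ℤ
  open import Data.Rational.Base
  open import Data.Rational.Properties
  import Data.Rational.Unnormalised.Base as ℚᵘ
  import Data.Rational.Unnormalised.Properties as ℚᵘ
  open import Algebra.Properties.CommutativeSemiring.Exp
    (CommutativeRing.commutativeSemiring +-*-commutativeRing) public
    using (_^_)
  open +-*-Solver

  -- Reduces an inequality to a ring identity: a visibly nonnegative `d` serves as certificate, and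
  -- the solver checks that it equals the difference.
  0≤-by : ∀ {p q d} → 0ℚ ≤ d → d ≡ q - p → p ≤ q
  0≤-by {p} {q} 0≤d d≡ = subst₂ _≤_ (+-identityˡ p)
    (trans (cong (_+ p) d≡) (solve 2 (λ p q → q :- p :+ p := q) refl p q))
    (+-monoˡ-≤ p 0≤d)

  p≤q⇒0≤q-p : ∀ {p q} → p ≤ q → 0ℚ ≤ q - p
  p≤q⇒0≤q-p {p} {q} p≤q = subst (_≤ q - p) (+-inverseʳ p) (+-monoˡ-≤ (- p) p≤q)

  *-monoʳ : ∀ {p q r} → 0ℚ ≤ r → p ≤ q → p * r ≤ q * r
  *-monoʳ {r = r} 0≤r = *-monoʳ-≤-nonNeg r {{nonNegative 0≤r}}

  *-monoˡ : ∀ {p q r} → 0ℚ ≤ r → p ≤ q → r * p ≤ r * q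
  *-monoˡ {r = r} 0≤r = *-monoˡ-≤-nonNeg r {{nonNegative 0≤r}}

  0≤* : ∀ {p q} → 0ℚ ≤ p → 0ℚ ≤ q → 0ℚ ≤ p * q
  0≤* {p} {q} 0≤p 0≤q = subst (_≤ p * q) (*-zeroˡ q) (*-monoʳ 0≤q 0≤p)

  0<* : ∀ {p q} → 0ℚ < p → 0ℚ < q → 0ℚ < p * q
  0<* {p} {q} 0<p 0<q =
    subst (_< p * q) (*-zeroˡ q) (*-monoˡ-<-pos q {{positive 0<q}} 0<p)

  *-mono : ∀ {p q r s} → 0ℚ ≤ r → 0ℚ ≤ q → p ≤ q → r ≤ s → p * r ≤ q * s
  *-mono 0≤r 0≤q p≤q r≤s = ≤-trans (*-monoʳ 0≤r p≤q) (*-monoˡ 0≤q r≤s)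

  0≤+ : ∀ {p q} → 0ℚ ≤ p → 0ℚ ≤ q → 0ℚ ≤ p + q
  0≤+ = +-mono-≤

  0<1/ : ∀ {p} (0<p : 0ℚ < p) → 0ℚ < (1/ p) {{>-nonZero 0<p}}
  0<1/ {p} 0<p = positive⁻¹ _ {{1/pos⇒pos p {{positive 0<p}}}}

  divide : ∀ {ε A} → 0ℚ < ε → 0ℚ < A → ∃[ δ ] (0ℚ < δ) × (δ * A ≡ ε)
  divide {ε} {A} 0<ε 0<A = ε * A⁻¹ , 0<* 0<ε (0<1/ 0<A) ,
    trans (*-assoc ε A⁻¹ A)
      (trans (cong (ε *_) (*-inverseˡ A {{>-nonZero 0<A}})) (*-identityʳ ε))
    where
    A⁻¹ = (1/ A) {{>-nonZero 0<A}}

  0≤1 : 0ℚ ≤ 1ℚ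
  0≤1 = nonNegative⁻¹ 1ℚ

  0<1 : 0ℚ < 1ℚ
  0<1 = positive⁻¹ 1ℚ

  p≤∣p∣ : ∀ p → p ≤ ∣ p ∣
  p≤∣p∣ p with ≤-total 0ℚ p
  ... | inj₁ 0≤p = ≤-reflexive (sym (0≤p⇒∣p∣≡p 0≤p))
  ... | inj₂ p≤0 = ≤-trans p≤0 (0≤∣p∣ p)

  -p≤∣p∣ : ∀ p → - p ≤ ∣ p ∣
  -p≤∣p∣ p = subst (- p ≤_) (∣-p∣≡∣p∣ p) (p≤∣p∣ (- p))

  ∣∣≤ : ∀ {p A} → p ≤ A → - p ≤ A → ∣ p ∣ ≤ A
  ∣∣≤ {p} {A} p≤A -p≤A with ∣p∣≡p∨∣p∣≡-p p
  ... | inj₁ eq = subst (_≤ A) (sym eq) p≤A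
  ... | inj₂ eq = subst (_≤ A) (sym eq) -p≤A

  ∣+∣≤ : ∀ {p q A B} → ∣ p ∣ ≤ A → ∣ q ∣ ≤ B → ∣ p + q ∣ ≤ A + B
  ∣+∣≤ {p} {q} p≤ q≤ = ≤-trans (∣p+q∣≤∣p∣+∣q∣ p q) (+-mono-≤ p≤ q≤)

  ∣*∣≤ : ∀ {p q A B} → 0ℚ ≤ A → ∣ p ∣ ≤ A → ∣ q ∣ ≤ B → ∣ p * q ∣ ≤ A * B
  ∣*∣≤ {p} {q} {A} {B} 0≤A p≤ q≤ = subst (_≤ A * B) (sym (∣p*q∣≡∣p∣*∣q∣ p q))
    (*-mono (0≤∣p∣ q) 0≤A p≤ q≤)

  0<½* : ∀ {ε} → 0ℚ < ε → 0ℚ < ½ * ε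
  0<½* = 0<* (positive⁻¹ ½)

  halves : ∀ ε → ½ * ε + ½ * ε ≡ ε
  halves = solve 1 (λ ε → con ½ :* ε :+ con ½ :* ε := ε) refl

  -- Natural numbers and unit fractions

  opaque
    -- Kept opaque so that `nat n` and `r i` act as atoms in ring identities, governed by equations
    -- such as `r*nat`. The shift in `r` avoids division by zero and matches sums indexed from 0.
    nat : ℕ → ℚ
    nat n = + n / 1

    r : ℕ → ℚ
    r i = + 1 / suc i

    nat-def : ∀ n → nat n ≡ + n / 1
    nat-def n = refl

    r-def : ∀ i → r i ≡ + 1 / suc i
    r-def i = refl

    nat-zero : nat 0 ≡ 0ℚ
    nat-zero = refl

    r-zero : r 0 ≡ 1ℚ
    r-zero = refl

    r-one : r 1 ≡ ½
    r-one = refl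

  -- Unnormalised fractions multiply and add without cancelling common factors; the two
  -- homomorphisms carry such computations over to `ℚ`.
  fromℚᵘ-homo-* : ∀ p q → fromℚᵘ (p ℚᵘ.* q) ≡ fromℚᵘ p * fromℚᵘ q
  fromℚᵘ-homo-* p q = toℚᵘ-injective
    (ℚᵘ.≃-trans (toℚᵘ-fromℚᵘ (p ℚᵘ.* q))
      (ℚᵘ.≃-sym (ℚᵘ.≃-trans (toℚᵘ-homo-* (fromℚᵘ p) (fromℚᵘ q))
        (ℚᵘ.*-cong (toℚᵘ-fromℚᵘ p) (toℚᵘ-fromℚᵘ q)))))

  fromℚᵘ-homo-+ : ∀ p q → fromℚᵘ (p ℚᵘ.+ q) ≡ fromℚᵘ p + fromℚᵘ q
  fromℚᵘ-homo-+ p q = toℚᵘ-injective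
    (ℚᵘ.≃-trans (toℚᵘ-fromℚᵘ (p ℚᵘ.+ q))
      (ℚᵘ.≃-sym (ℚᵘ.≃-trans (toℚᵘ-homo-+ (fromℚᵘ p) (fromℚᵘ q))
        (ℚᵘ.+-cong (toℚᵘ-fromℚᵘ p) (toℚᵘ-fromℚᵘ q)))))

  1/-* : ∀ m n .{{_ : ℕ.NonZero m}} .{{_ : ℕ.NonZero n}} .{{_ : ℕ.NonZero (m ℕ.* n)}} →
         + 1 / (m ℕ.* n) ≡ (+ 1 / m) * (+ 1 / n)
  1/-* (suc m) (suc n) = fromℚᵘ-homo-* (ℚᵘ.mkℚᵘ (+ 1) m) (ℚᵘ.mkℚᵘ (+ 1) n)

  opaque
    unfolding nat r

    nat-suc : ∀ n → nat (suc n) ≡ 1ℚ + nat n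
    nat-suc n = trans
      (fromℚᵘ-cong {ℚᵘ.mkℚᵘ (+ suc n) 0} {ℚᵘ.mkℚᵘ (+ 1) 0 ℚᵘ.+ ℚᵘ.mkℚᵘ (+ n) 0}
        (ℚᵘ.*≡* (cong (λ k → ((+ 1) ℤ.+ k) ℤ.* (+ 1)) (sym (ℤ.*-identityʳ (+ n))))))
      (fromℚᵘ-homo-+ (ℚᵘ.mkℚᵘ (+ 1) 0) (ℚᵘ.mkℚᵘ (+ n) 0))

    r*nat : ∀ i → r i * nat (suc i) ≡ 1ℚ
    r*nat i = trans (sym (fromℚᵘ-homo-* (ℚᵘ.mkℚᵘ (+ 1) i) (ℚᵘ.mkℚᵘ (+ suc i) 0)))
      (fromℚᵘ-cong {ℚᵘ.mkℚᵘ (+ 1) i ℚᵘ.* ℚᵘ.mkℚᵘ (+ suc i) 0} {ℚᵘ.mkℚᵘ (+ 1) 0}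
        (ℚᵘ.*≡* (trans (ℤ.*-identityʳ _) (trans (ℤ.*-identityˡ (+ suc i)) 
           (trans (sym (cong +_ (ℕ.*-identityʳ (suc i)))) (sym (ℤ.*-identityˡ _)))))))

    0<r : ∀ i → 0ℚ < r i
    0<r i = positive⁻¹ (r i) {{normalize-pos 1 (suc i)}}

    r*r : ∀ m n → r m * r n ≡ r (n ℕ.+ m ℕ.* suc n)
    r*r m n = sym (1/-* (suc m) (suc n))

    -- The denominator is at least 1, so the absolute value of the numerator is large enough.
    archimedean : ∀ p → ∃[ n ] p ≤ nat n
    archimedean p@(mkℚ n d c) = ℤ.∣ n ∣ , toℚᵘ-cancel-≤
      (ℚᵘ.≤-respʳ-≃ (ℚᵘ.≃-sym (toℚᵘ-fromℚᵘ (ℚᵘ.mkℚᵘ (+ ℤ.∣ n ∣) 0)))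
        (ℚᵘ.*≤* (bound n)))
      where
      bound : ∀ n → n ℤ.* + 1 ℤ.≤ (+ ℤ.∣ n ∣) ℤ.* + suc d
      bound (+ k) = subst₂ ℤ._≤_ (ℤ.pos-* k 1) (ℤ.pos-* k (suc d))
        (ℤ.+≤+ (ℕ.*-monoʳ-≤ k (ℕ.s≤s ℕ.z≤n)))
      bound (ℤ.-[1+ k ]) = ℤ.-≤+

  0≤r : ∀ i → 0ℚ ≤ r i
  0≤r i = <⇒≤ (0<r i)

  0≤nat : ∀ n → 0ℚ ≤ nat n
  0≤nat zero    = ≤-reflexive (sym nat-zero)
  0≤nat (suc n) = subst (0ℚ ≤_) (sym (nat-suc n)) (0≤+ 0≤1 (0≤nat n))

  ^-nonNeg : ∀ {p} n → 0ℚ ≤ p → 0ℚ ≤ p ^ n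
  ^-nonNeg zero    0≤p = 0≤1
  ^-nonNeg (suc n) 0≤p = 0≤* 0≤p (^-nonNeg n 0≤p)

  nat-mono : ∀ {m n} → m ℕ.≤ n → nat m ≤ nat n
  nat-mono {n = n} ℕ.z≤n               = subst (_≤ nat n) (sym nat-zero) (0≤nat n)
  nat-mono         (ℕ.s≤s {m} {n} m≤n) = subst₂ _≤_ (sym (nat-suc m)) (sym (nat-suc n))
    (+-monoʳ-≤ 1ℚ (nat-mono m≤n))

  1/-difference : ∀ a b x y → a * x ≡ 1ℚ → b * y ≡ 1ℚ → a - b ≡ (y - x) * (a * b)
  1/-difference a b x y ax≡1 by≡1 = sym (trans
    (solve 4 (λ a b x y → (y :- x) :* (a :* b) := a :* (b :* y) :- b :* (a :* x)) refl a b x y)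
    (cong₂ _-_ (trans (cong (a *_) by≡1) (*-identityʳ a))
               (trans (cong (b *_) ax≡1) (*-identityʳ b))))

  -- Partial fractions for 1/(k(k+1)) with k = i + 1; the telescoping of the series rests on this
  -- and on the two-step version `r-difference₂`.
  r-difference : ∀ i → r i - r (suc i) ≡ r i * r (suc i)
  r-difference i = trans
    (1/-difference (r i) (r (suc i)) (nat (suc i)) (nat (suc (suc i))) (r*nat i) (r*nat (suc i)))
    (trans (cong (λ n → (n - nat (suc i)) * (r i * r (suc i))) (nat-suc (suc i)))
      (solve 2 (λ n p → (con 1ℚ :+ n :- n) :* p := p) refl (nat (suc i)) (r i * r (suc i))))

  r-difference₂ : ∀ i → r i - r (suc (suc i)) ≡ (1ℚ + 1ℚ) * (r i * r (suc (suc i)))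
  r-difference₂ i = trans
    (1/-difference (r i) (r (2 ℕ.+ i)) (nat (suc i)) (nat (3 ℕ.+ i)) (r*nat i) (r*nat (2 ℕ.+ i)))
    (trans (cong (λ n → (n - nat (suc i)) * (r i * r (2 ℕ.+ i)))
             (trans (nat-suc (2 ℕ.+ i)) (cong (_+_ 1ℚ) (nat-suc (suc i)))))
      (solve 2 (λ n p → (con 1ℚ :+ (con 1ℚ :+ n) :- n) :* p := (con 1ℚ :+ con 1ℚ) :* p) refl
        (nat (suc i)) (r i * r (2 ℕ.+ i))))

  r-step : ∀ i → r (suc i) ≤ r i
  r-step i = 0≤-by (0≤* (0≤r i) (0≤r (suc i))) (sym (r-difference i))

  r-antitone : ∀ {m n} → m ℕ.≤ n → r n ≤ r m
  r-antitone {m} {n} m≤n = subst (λ k → r k ≤ r m) (ℕ.m∸n+n≡m m≤n) (go (n ∸ m))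
    where
    go : ∀ k → r (k ℕ.+ m) ≤ r m
    go zero    = ≤-refl
    go (suc k) = ≤-trans (r-step (k ℕ.+ m)) (go k)

  -- The product (m+1)(n+1) is at least m+n+1. This compares a shifted harmonic sum with the
  -- harmonic series in `majorant-decay`.
  r*r≤ : ∀ m n → r m * r n ≤ r (n ℕ.+ m)
  r*r≤ m n = subst (_≤ r (n ℕ.+ m)) (sym (r*r m n))
    (r-antitone (ℕ.+-monoʳ-≤ n (ℕ.m≤m*n m (suc n))))

  -- Finite sums, divergence of the harmonic series, Bernoulli's inequality

  σ : ℕ → (ℕ → ℚ) → ℚ
  σ zero    f = 0ℚ
  σ (suc n) f = σ n f + f n

  σ-cong : ∀ n {f g} → (∀ i → f i ≡ g i) → σ n f ≡ σ n g
  σ-cong zero    f≡g = refl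
  σ-cong (suc n) f≡g = cong₂ _+_ (σ-cong n f≡g) (f≡g n)

  σ-head : ∀ n f → σ (suc n) f ≡ f 0 + σ n (λ i → f (suc i))
  σ-head zero    f = +-comm 0ℚ (f 0)
  σ-head (suc n) f = trans (cong (_+ f (suc n)) (σ-head n f))
                           (+-assoc (f 0) _ (f (suc n)))

  σ-neg : ∀ n f → σ n (λ i → - f i) ≡ - σ n f
  σ-neg zero    f = refl
  σ-neg (suc n) f = trans (cong (_- f n) (σ-neg n f)) (sym (neg-distrib-+ (σ n f) (f n)))

  harmonic-growth : ∀ n j → σ n r + nat j * r (j ℕ.+ n) ≤ σ (j ℕ.+ n) r
  harmonic-growth n zero    = ≤-reflexive (trans
    (cong (λ m → σ n r + m * r n) nat-zero)
    (solve 2 (λ h x → h :+ con 0ℚ :* x := h) refl (σ n r) (r n)))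
  harmonic-growth n (suc j) = begin
    σ n r + nat (suc j) * r (suc j ℕ.+ n)
      ≤⟨ +-monoʳ-≤ (σ n r) (*-monoˡ (0≤nat (suc j)) (r-step (j ℕ.+ n))) ⟩
    σ n r + nat (suc j) * x
      ≡⟨ cong (λ m → σ n r + m * x) (nat-suc j) ⟩
    σ n r + (1ℚ + nat j) * x
      ≡⟨ solve 3 (λ h k x → h :+ (con 1ℚ :+ k) :* x := h :+ k :* x :+ x) refl (σ n r) (nat j) x ⟩
    σ n r + nat j * x + x
      ≤⟨ +-monoˡ-≤ x (harmonic-growth n j) ⟩
    σ (suc j ℕ.+ n) r ∎
    where
    open ≤-Reasoning
    x = r (j ℕ.+ n)

  -- The n+1 terms after the first n are each at least 1/(2n+2), so together they contribute at
  -- least 1/2.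
  harmonic-doubling : ∀ n → σ n r + r 1 ≤ σ (suc n ℕ.+ n) r
  harmonic-doubling n = subst (λ x → σ n r + x ≤ σ (suc n ℕ.+ n) r) lemma (harmonic-growth n (suc n))
    where
    lemma : nat (suc n) * r (suc n ℕ.+ n) ≡ r 1
    lemma = trans (cong (λ k → nat (suc n) * r k)
        (trans (ℕ.+-comm (suc n) n) (cong (n ℕ.+_) (sym (ℕ.*-identityˡ (suc n))))))
      (trans (cong (nat (suc n) *_) (sym (r*r 1 n)))
      (trans (solve 3 (λ m a b → m :* (a :* b) := a :* (b :* m)) refl (nat (suc n)) (r 1) (r n))
      (trans (cong (r 1 *_) (r*nat n)) (*-identityʳ (r 1)))))

  -- Each doubling of the range gains 1/2, so any natural number k of doublings with 2B ≤ k
  -- suffices.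
  harmonic-unbounded : ∀ B → ∃[ n ] B ≤ σ n r
  harmonic-unbounded B =
    let k , 2B≤k = archimedean (B * (1ℚ + 1ℚ))
        n , le   = reach k
    in n , ≤-trans
      (subst (_≤ nat k * r 1)
        (trans (cong (B * (1ℚ + 1ℚ) *_) r-one)
          (solve 1 (λ B → B :* (con 1ℚ :+ con 1ℚ) :* con ½ := B) refl B))
        (*-monoʳ (0≤r 1) 2B≤k)) le
    where
    reach : ∀ k → ∃[ n ] nat k * r 1 ≤ σ n r
    reach zero    = 0 , ≤-reflexive (trans (cong (_* r 1) nat-zero) (*-zeroˡ (r 1)))
    reach (suc k) =
      let n , le = reach k
      in suc n ℕ.+ n , ≤-trans
        (≤-trans (≤-reflexive (trans (cong (_* r 1) (nat-suc k))
                   (solve 2 (λ k a → (con 1ℚ :+ k) :* a := k :* a :+ a) refl (nat k) (r 1))))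
                 (+-monoˡ-≤ (r 1) le))
        (harmonic-doubling n)

  -- Bernoulli's inequality 1 + t/l ≤ (1 + 1/l)^t for l = i + 1, multiplied by l/(l+1)^t so that it
  -- compares powers of consecutive unit fractions.
  bernoulli : ∀ i t → (nat (suc i) + nat t) * r (suc i) ^ t ≤ nat (suc i) * r i ^ t
  bernoulli i zero    = ≤-reflexive
    (cong (_* 1ℚ) (trans (cong (_+_ (nat (suc i))) nat-zero) (+-identityʳ (nat (suc i)))))
  bernoulli i (suc t) = begin
    (l + nat (suc t)) * (b * b ^ t)
      ≡⟨ *-assoc (l + nat (suc t)) b (b ^ t) ⟨
    (l + nat (suc t)) * b * b ^ t
      ≤⟨ *-monoʳ (^-nonNeg t (0≤r (suc i))) (0≤-by {(l + nat (suc t)) * b} {(l + T) * a} (0≤* (0≤* (0≤r i) (0≤r (suc i))) (0≤nat t)) step) ⟩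
    (l + T) * a * b ^ t
      ≡⟨ solve 3 (λ x a y → x :* a :* y := a :* (x :* y)) refl (l + T) a (b ^ t) ⟩
    a * ((l + T) * b ^ t)
      ≤⟨ *-monoˡ (0≤r i) (bernoulli i t) ⟩
    a * (l * a ^ t)
      ≡⟨ solve 3 (λ a l x → a :* (l :* x) := l :* (a :* x)) refl a l (a ^ t) ⟩
    l * (a * a ^ t) ∎
    where
    open ≤-Reasoning
    a = r i
    b = r (suc i)
    l = nat (suc i)
    T = nat t
    b*[1+l] : b * (1ℚ + l) ≡ 1ℚ
    b*[1+l] = trans (cong (b *_) (sym (nat-suc (suc i)))) (r*nat (suc i))
    -- (l+T)/l exceeds (l+T+1)/(l+1) by T/(l(l+1)).
    step : a * b * T ≡ (l + T) * a - (l + nat (suc t)) * b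
    step = trans
      (solve 4 (λ a b l T → a :* b :* T :=
          (l :+ T) :* a :* (b :* (con 1ℚ :+ l)) :- (l :+ (con 1ℚ :+ T)) :* b :* (a :* l)) refl a b l T)
      (cong₂ _-_ (trans (cong ((l + T) * a *_) b*[1+l]) (*-identityʳ ((l + T) * a)))
                 (trans (cong₂ (λ m x → (l + m) * b * x) (sym (nat-suc t)) (r*nat i))
                   (*-identityʳ ((l + nat (suc t)) * b))))

  -- Coefficients and finite summation identities

  -- Indices are shifted by one: coeff q i is the coefficient of 1 / (i + 1)ˢ in ζ_q(s).
  coeff : ℚ → ℕ → ℚ
  coeff q zero    = 1ℚ
  coeff q (suc i) = coeff q i * (1ℚ - q * r i)

  -- One sum for two objects: the partial sum of ζ_q(s), and the harmonic number of order s and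
  -- index n, whose terms have the same value.
  partial : ℚ → ℕ → ℕ → ℚ
  partial q s n = σ n (λ i → coeff q i * r i ^ s)

  -- Partial sums of Tₚ.
  mixed : ℚ → ℕ → ℕ → ℚ
  mixed q p n = σ n (λ i → coeff q i * r i ^ p * r (suc i))

  -- Consecutive coefficients differ by -q aₗ/l, and these differences add up to the harmonic number
  -- of order 1. This brings the remainder in `mixed-one` within reach of Kronecker's lemma.
  coeff-partial : ∀ q n → coeff q n ≡ 1ℚ - q * partial q 1 n
  coeff-partial q zero    = solve 1 (λ q → con 1ℚ := con 1ℚ :- q :* con 0ℚ) refl q
  coeff-partial q (suc n) = trans
    (solve 3 (λ c q a → c :* (con 1ℚ :- q :* a) := c :- q :* (c :* (a :* con 1ℚ))) refl (coeff q n) q (r n))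
    (trans (cong (_- q * x) (coeff-partial q n))
      (solve 3 (λ q p x → con 1ℚ :- q :* p :- q :* x := con 1ℚ :- q :* (p :+ x)) refl q (partial q 1 n) x))
    where
    x = coeff q n * r n ^ 1

  -- Telescoping: aₗ/l - aₗ₊₁/(l+1) = (q+1) aₗ/(l(l+1)), because aₗ₊₁ = aₗ (1 - q/l).
  mixed-one : ∀ q n → mixed q 1 n * (q + 1ℚ) ≡ 1ℚ - coeff q n * r n
  mixed-one q zero    = trans (*-zeroˡ (q + 1ℚ)) (cong (λ x → 1ℚ - 1ℚ * x) (sym r-zero))
  mixed-one q (suc n) = trans (*-distribʳ-+ (q + 1ℚ) (mixed q 1 n) (coeff q n * a ^ 1 * b))
    (trans (cong (_+ coeff q n * a ^ 1 * b * (q + 1ℚ)) (mixed-one q n))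
    (trans (solve 4 (λ c q a b → con 1ℚ :- c :* a :+ c :* (a :* con 1ℚ) :* b :* (q :+ con 1ℚ)
                := con 1ℚ :- c :* (a :- a :* b :- q :* a :* b)) refl (coeff q n) q a b)
    (trans (cong (λ x → 1ℚ - coeff q n * (a - x - q * a * b)) (sym (r-difference n)))
      (solve 4 (λ c q a b → con 1ℚ :- c :* (a :- (a :- b) :- q :* a :* b)
        := con 1ℚ :- c :* (con 1ℚ :- q :* a) :* b) refl (coeff q n) q a b))))
    where
    a = r n
    b = r (suc n)

  mixed-suc : ∀ q p n → mixed q (suc p) n ≡ partial q (suc p) n - mixed q p n
  mixed-suc q p zero    = refl
  mixed-suc q p (suc n) = trans (cong₂ _+_ (mixed-suc q p n)
    (trans (solve 4 (λ c a b x → c :* (a :* x) :* b := c :* x :* (a :* b)) refl (coeff q n) (r n) (r (suc n)) (r n ^ p))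
      (cong (coeff q n * r n ^ p *_) (sym (r-difference n)))))
    (solve 6 (λ P M c a b x → P :- M :+ c :* x :* (a :- b) := P :+ c :* (a :* x) :- (M :+ c :* x :* b)) refl
      (partial q (suc p) n) (mixed q p n) (coeff q n) (r n) (r (suc n)) (r n ^ p))

  -- Abel summation, the identity behind Kronecker's lemma.
  partial-abel : ∀ q p n →
    partial q p n ≡ nat n * partial q (suc p) n - σ n (partial q (suc p))
  partial-abel q p zero    = cong (λ x → x - 0ℚ) (sym (*-zeroʳ (nat 0)))
  partial-abel q p (suc n) = trans (cong₂ _+_ (partial-abel q p n)
      (trans (trans (sym (*-identityʳ _)) (cong (coeff q n * r n ^ p *_) (sym (r*nat n))))
        (cong (λ m → coeff q n * r n ^ p * (r n * m)) (nat-suc n))))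
    (trans (solve 6 (λ m P S c a x → m :* P :- S :+ c :* x :* (a :* (con 1ℚ :+ m))
        := (con 1ℚ :+ m) :* (P :+ c :* (a :* x)) :- (S :+ P)) refl
        (nat n) (partial q (suc p) n) (σ n (partial q (suc p))) (coeff q n) (r n) (r n ^ p))
      (cong (λ m → m * partial q (suc p) (suc n) - σ (suc n) (partial q (suc p))) (sym (nat-suc n))))

  -- Summation by parts: Hₖ/k - Hₖ/(k+1) is the telescoping difference Hₖ₋₁/k - Hₖ/(k+1) plus the
  -- increment aₖ/kᵖ⁺¹.
  sum-k[k+1] : ∀ q p n → σ n (λ i → partial q p (suc i) * (r i * r (suc i)))
                       ≡ partial q (suc p) n - partial q p n * r n
  sum-k[k+1] q p zero    = cong (λ x → 0ℚ - x) (sym (*-zeroˡ (r 0)))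
  sum-k[k+1] q p (suc n) = trans (cong₂ _+_ (sum-k[k+1] q p n)
      (cong (partial q p (suc n) *_) (sym (r-difference n))))
    (solve 6 (λ P H c a b x → P :- H :* a :+ (H :+ c :* x) :* (a :- b)
        := P :+ c :* (a :* x) :- (H :+ c :* x) :* b) refl
      (partial q (suc p) n) (partial q p n) (coeff q n) (r n) (r (suc n)) (r n ^ p))

  -- Summation by parts again, with 1/(k(k+2)) split into half of 1/k - 1/(k+1) and half of 1/(k+1)
  -- - 1/(k+2). In the second half the increments of H meet 1/(k+1), which produces `mixed`.
  sum-k[k+2] : ∀ q p n → σ n (λ i → partial q p (suc i) * (r i * r (2 ℕ.+ i)))
    ≡ ½ * (partial q (suc p) n + mixed q p n - partial q p n * (r n + r (suc n)))
  sum-k[k+2] q p zero    =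
    solve 1 (λ x → con 0ℚ := con ½ :* (con 0ℚ :+ con 0ℚ :- con 0ℚ :* x)) refl (r 0 + r 1)
  sum-k[k+2] q p (suc n) = trans (cong₂ _+_ (sum-k[k+2] q p n) half-difference)
    (solve 8 (λ P M H c a b d x →
        con ½ :* (P :+ M :- H :* (a :+ b)) :+ con ½ :* ((H :+ c :* x) :* (a :- d))
        := con ½ :* (P :+ c :* (a :* x) :+ (M :+ c :* x :* b) :- (H :+ c :* x) :* (b :+ d))) refl
      (partial q (suc p) n) (mixed q p n) (partial q p n) (coeff q n) (r n) (r (suc n)) (r (2 ℕ.+ n)) (r n ^ p))
    where
    half-difference : partial q p (suc n) * (r n * r (2 ℕ.+ n))
                    ≡ ½ * (partial q p (suc n) * (r n - r (2 ℕ.+ n)))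
    half-difference = trans
      (solve 2 (λ H x → H :* x := con ½ :* (H :* ((con 1ℚ :+ con 1ℚ) :* x))) refl
        (partial q p (suc n)) (r n * r (2 ℕ.+ n)))
      (cong (λ x → ½ * (partial q p (suc n) * x)) (sym (r-difference₂ n)))

  -- Decay of the majorant and uniform tail bounds

  module _ (q : ℚ) (A : ℕ) (∣q∣≤A : ∣ q ∣ ≤ nat A) (δ : ℚ) (0<δ : 0ℚ < δ)
           (t : ℕ) (δ≤t+q : δ ≤ nat t + q) where

    κ : ℚ
    κ = ½ * δ

    -- This is bₗ for l = i + 1 and s = t + 1, so that s + q - 1 = t + q. Since κ depends only on
    -- the lower bound δ of t + q, one rate serves all admissible q.
    majorant : ℕ → ℚ
    majorant i = ∣ coeff q i ∣ * r i ^ t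

    0≤κ : 0ℚ ≤ κ
    0≤κ = <⇒≤ (0<½* 0<δ)

    0≤majorant : ∀ i → 0ℚ ≤ majorant i
    0≤majorant i = 0≤* (0≤∣p∣ (coeff q i)) (^-nonNeg t (0≤r i))

    -- After multiplication by e = l - q > 0, Bernoulli bounds bₗ₊₁ (l + t) by e bₗ. Moreover l + t
    -- exceeds e (1 + κ/l) by t + q - κ (1 - q/l) ≥ δ (1 + q/l)/2 ≥ 0.
    majorant-step : ∀ i → A ℕ.≤ i →
      majorant (suc i) * (1ℚ + κ * r i) ≤ majorant i
    majorant-step i A≤i = *-cancelˡ-≤-pos e {{positive 0<e}}
      (0≤-by (0≤+ (0≤+ (p≤q⇒0≤q-p step) (0≤* 0≤c′ (p≤q⇒0≤q-p δ≤t+q)))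
               (0≤* (0≤* (<⇒≤ 0<δ) 0≤c′) (0≤* (nonNegative⁻¹ ½) 0≤1+qa)))
             certificate)
      where
      l = nat (suc i)
      a = r i
      P = ∣ coeff q i ∣
      x = r i ^ t
      y = r (suc i) ^ t
      e = l - q
      c = majorant i
      c′ = majorant (suc i)
      A+1≤l : 1ℚ + nat A ≤ l
      A+1≤l = subst (_≤ l) (nat-suc A) (nat-mono (ℕ.s≤s A≤i))
      A≤l : nat A ≤ l
      A≤l = nat-mono (ℕ.m≤n⇒m≤1+n A≤i)
      0<e : 0ℚ < e
      0<e = <-≤-trans 0<1 (0≤-by (0≤+ (p≤q⇒0≤q-p A+1≤l) (p≤q⇒0≤q-p (≤-trans (p≤∣p∣ q) ∣q∣≤A)))
        (solve 3 (λ A l q → l :- (con 1ℚ :+ A) :+ (A :- q) := l :- q :- con 1ℚ) refl (nat A) l q))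
      ae : a * e ≡ 1ℚ - q * a
      ae = trans (solve 3 (λ a l q → a :* (l :- q) := a :* l :- q :* a) refl a l q)
        (cong (_- q * a) (r*nat i))
      0≤1-qa : 0ℚ ≤ 1ℚ - q * a
      0≤1-qa = subst (0ℚ ≤_) ae (0≤* (0≤r i) (<⇒≤ 0<e))
      0≤1+qa : 0ℚ ≤ 1ℚ + q * a
      0≤1+qa = subst (0ℚ ≤_)
        (trans (solve 3 (λ a l q → a :* (l :- (:- q)) := a :* l :+ q :* a) refl a l q)
          (cong (_+ q * a) (r*nat i)))
        (0≤* (0≤r i) (p≤q⇒0≤q-p (≤-trans (-p≤∣p∣ q) (≤-trans ∣q∣≤A A≤l))))
      c′≡ : c′ ≡ P * (a * e) * y
      c′≡ = cong (_* y) (trans (∣p*q∣≡∣p∣*∣q∣ (coeff q i) (1ℚ - q * a))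
        (cong (P *_) (trans (0≤p⇒∣p∣≡p 0≤1-qa) (sym ae))))
      0≤c′ = 0≤majorant (suc i)
      step : c′ * (l + nat t) ≤ e * c
      step = begin
        c′ * (l + nat t)
          ≡⟨ cong (_* (l + nat t)) c′≡ ⟩
        P * (a * e) * y * (l + nat t)
          ≡⟨ solve 5 (λ P a e y m → P :* (a :* e) :* y :* m := P :* (a :* e) :* (m :* y)) refl
               P a e y (l + nat t) ⟩
        P * (a * e) * ((l + nat t) * y)
          ≤⟨ *-monoˡ (0≤* (0≤∣p∣ (coeff q i)) (subst (0ℚ ≤_) (sym ae) 0≤1-qa)) (bernoulli i t) ⟩
        P * (a * e) * (l * x)
          ≡⟨ solve 5 (λ P a e l x → P :* (a :* e) :* (l :* x) := e :* (P :* x) :* (a :* l)) refl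
               P a e l x ⟩
        e * c * (a * l)
          ≡⟨ trans (cong (e * c *_) (r*nat i)) (*-identityʳ (e * c)) ⟩
        e * c ∎
        where open ≤-Reasoning
      -- The summands are the gap in Bernoulli's bound, the slack in δ ≤ t + q, and what remains of
      -- δ. Replacing 1 + q a by 2 - a e absorbs the relation a l = 1 and leaves a polynomial
      -- identity.
      certificate :
        (e * c - c′ * (l + nat t)) + c′ * (nat t + q - δ) + δ * c′ * (½ * (1ℚ + q * a))
        ≡ e * c - e * (c′ * (1ℚ + κ * a))
      certificate = trans
        (cong (λ u → (e * c - c′ * (l + nat t)) + c′ * (nat t + q - δ) + δ * c′ * (½ * u))
          (trans (solve 1 (λ x → con 1ℚ :+ x := con 1ℚ :+ con 1ℚ :- (con 1ℚ :- x)) refl (q * a))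
            (cong (λ u → 1ℚ + 1ℚ - u) (sym ae))))
        (solve 7 (λ c c′ l q T δ a →
           ((l :- q) :* c :- c′ :* (l :+ T)) :+ c′ :* (T :+ q :- δ)
             :+ δ :* c′ :* (con ½ :* (con 1ℚ :+ con 1ℚ :- a :* (l :- q)))
           := (l :- q) :* c :- (l :- q) :* (c′ :* (con 1ℚ :+ con ½ :* δ :* a))) refl
           c c′ l q (nat t) δ a)

    -- Iterating `majorant-step` produces the product of the factors 1 + κ r (A + i), which
    -- dominates 1 plus κ times the sum of the r (A + i); `r*r≤` bounds that sum below by r A times
    -- a harmonic sum.
    majorant-decay : ∀ j →
      majorant (j ℕ.+ A) * (1ℚ + κ * r A * σ j r) ≤ majorant A
    majorant-decay zero    = ≤-reflexive
      (solve 2 (λ c k → c :* (con 1ℚ :+ k :* con 0ℚ) := c) refl (majorant A) (κ * r A))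
    majorant-decay (suc j) = ≤-trans
      (≤-trans
        (*-monoˡ (0≤majorant (suc (j ℕ.+ A))) (0≤-by
          (0≤+ (0≤* 0≤κ (p≤q⇒0≤q-p (r*r≤ A j)))
            (0≤* (0≤* 0≤κ (0≤r (j ℕ.+ A))) (0≤* (0≤* 0≤κ (0≤r A)) (0≤σr j))))
          (solve 5 (λ k x a h y → k :* (x :- a :* y) :+ k :* x :* (k :* a :* h)
             := (con 1ℚ :+ k :* x) :* (con 1ℚ :+ k :* a :* h) :- (con 1ℚ :+ k :* a :* (h :+ y)))
             refl κ (r (j ℕ.+ A)) (r A) (σ j r) (r j))))
        (≤-trans (≤-reflexive (sym (*-assoc (majorant (suc (j ℕ.+ A))) (1ℚ + κ * r (j ℕ.+ A)) _)))
          (*-monoʳ (0≤+ 0≤1 (0≤* (0≤* 0≤κ (0≤r A)) (0≤σr j)))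
            (majorant-step (j ℕ.+ A) (ℕ.m≤n+m A j)))))
      (majorant-decay j)
      where
      0≤σr : ∀ n → 0ℚ ≤ σ n r
      0≤σr zero    = ≤-refl
      0≤σr (suc n) = 0≤+ (0≤σr n) (0≤r n)

    -- By `majorant-step`, κ bₗ₊₁/l ≤ bₗ - bₗ₊₁, and the term of index l+1 has absolute value
    -- bₗ₊₁/(l+1). Each term is thus paid for by the preceding step of b, hence the tail starts one
    -- index later than the majorant.
    tail≤majorant : ∀ N → A ℕ.≤ N → ∀ j →
      κ * ∣ partial q (suc t) (suc (j ℕ.+ N)) - partial q (suc t) (suc N) ∣
        ≤ majorant N - majorant (j ℕ.+ N)
    tail≤majorant N A≤N zero    = ≤-reflexive (trans
      (cong (λ x → κ * ∣ x ∣) (+-inverseʳ (partial q (suc t) (suc N))))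
      (trans (*-zeroʳ κ) (sym (+-inverseʳ (majorant N)))))
    tail≤majorant N A≤N (suc j) = begin
      κ * ∣ F (suc k) + u - F (suc N) ∣
        ≡⟨ cong (λ x → κ * ∣ x ∣)
             (solve 3 (λ a b c → a :+ b :- c := (a :- c) :+ b) refl (F (suc k)) u (F (suc N))) ⟩
      κ * ∣ (F (suc k) - F (suc N)) + u ∣
        ≤⟨ *-monoˡ 0≤κ (∣p+q∣≤∣p∣+∣q∣ (F (suc k) - F (suc N)) u) ⟩
      κ * (∣ F (suc k) - F (suc N) ∣ + ∣ u ∣)
        ≡⟨ *-distribˡ-+ κ _ ∣ u ∣ ⟩
      κ * ∣ F (suc k) - F (suc N) ∣ + κ * ∣ u ∣
        ≤⟨ +-mono-≤ (tail≤majorant N A≤N j) term ⟩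
      (majorant N - majorant k) + (majorant k - majorant (suc k))
        ≡⟨ solve 3 (λ a b c → (a :- b) :+ (b :- c) := a :- c) refl
             (majorant N) (majorant k) (majorant (suc k)) ⟩
      majorant N - majorant (suc k) ∎
      where
      open ≤-Reasoning
      F = partial q (suc t)
      k = j ℕ.+ N
      u = coeff q (suc k) * r (suc k) ^ suc t
      c′ = majorant (suc k)
      ∣u∣ : ∣ u ∣ ≡ r (suc k) * c′
      ∣u∣ = trans (∣p*q∣≡∣p∣*∣q∣ (coeff q (suc k)) (r (suc k) ^ suc t))
        (trans (cong (∣ coeff q (suc k) ∣ *_) (0≤p⇒∣p∣≡p (^-nonNeg (suc t) (0≤r (suc k)))))
          (solve 3 (λ c a x → c :* (a :* x) := a :* (c :* x)) refl
            ∣ coeff q (suc k) ∣ (r (suc k)) (r (suc k) ^ t)))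
      term : κ * ∣ u ∣ ≤ majorant k - c′
      term = begin
        κ * ∣ u ∣             ≡⟨ cong (κ *_) ∣u∣ ⟩
        κ * (r (suc k) * c′)  ≤⟨ *-monoˡ 0≤κ (*-monoʳ (0≤majorant (suc k)) (r-step k)) ⟩
        κ * (r k * c′)        ≤⟨ 0≤-by (p≤q⇒0≤q-p (majorant-step k (ℕ.≤-trans A≤N (ℕ.m≤n+m N j))))
                                   (solve 4 (λ c c′ k a → c :- c′ :* (con 1ℚ :+ k :* a)
                                       := c :- c′ :- k :* (a :* c′)) refl (majorant k) c′ κ (r k)) ⟩
        majorant k - c′       ∎

  -- N is found from A, δ, t, B and ε before q is given; this uniformity lets the bound be applied
  -- to all late terms of a Cauchy sequence at once.
  tail-bound : ∀ A δ → 0ℚ < δ → ∀ t B → 0ℚ < B → ∀ ε → 0ℚ < ε →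
    ∃[ N ] (∀ q → ∣ q ∣ ≤ nat A → δ ≤ nat t + q → ∣ coeff q A ∣ * r A ^ t ≤ B →
      ∀ n → n ℕ.≥ N → ∣ partial q (suc t) n - partial q (suc t) N ∣ ≤ ε)
  tail-bound A δ 0<δ t B 0<B ε 0<ε =
    -- D = B/(κ ε) is the factor by which the majorant must shrink, and h = D/(κ r A) is a harmonic
    -- sum that forces it through `majorant-decay`.
    let D , 0<D , Dκε≡B = divide 0<B (0<* (0<½* 0<δ) 0<ε)
        h , _ , hκr≡D   = divide 0<D (0<* (0<½* 0<δ) (0<r A))
        j , h≤σ         = harmonic-unbounded h
    in suc (j ℕ.+ A) , bound D h j 0<D Dκε≡B hκr≡D h≤σ
    where
    bound : ∀ D h j → 0ℚ < D → D * (½ * δ * ε) ≡ B → h * (½ * δ * r A) ≡ D → h ≤ σ j r →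
      ∀ q → ∣ q ∣ ≤ nat A → δ ≤ nat t + q → ∣ coeff q A ∣ * r A ^ t ≤ B →
      ∀ n → n ℕ.≥ suc (j ℕ.+ A) →
      ∣ partial q (suc t) n - partial q (suc t) (suc (j ℕ.+ A)) ∣ ≤ ε
    bound D h j 0<D Dκε≡B hκr≡D h≤σ q ∣q∣≤A δ≤ cA≤B n n≥ = subst (λ n → ∣ F n - F (suc N) ∣ ≤ ε)
        (trans (sym (ℕ.+-suc (n ∸ suc N) N)) (ℕ.m∸n+n≡m n≥))
        (*-cancelˡ-≤-pos k {{positive (0<½* 0<δ)}} (≤-trans (tail≤majorant′ N (ℕ.m≤n+m A j) (n ∸ suc N))
          (≤-trans (0≤-by (0≤majorant′ (n ∸ suc N ℕ.+ N))
             (solve 2 (λ a b → b := a :- (a :- b)) refl (c N) (c (n ∸ suc N ℕ.+ N)))) cN≤)))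
      where
      F = partial q (suc t)
      N = j ℕ.+ A
      k = ½ * δ
      c = majorant q A ∣q∣≤A δ 0<δ t δ≤
      tail≤majorant′ = tail≤majorant q A ∣q∣≤A δ 0<δ t δ≤
      0≤majorant′ = 0≤majorant q A ∣q∣≤A δ 0<δ t δ≤
      cN≤ : c N ≤ k * ε
      cN≤ = *-cancelʳ-≤-pos D {{positive 0<D}} (begin
        c N * D
          ≡⟨ cong (c N *_) (trans (sym hκr≡D) (*-comm h (k * r A))) ⟩
        c N * (k * r A * h)
          ≤⟨ *-monoˡ (0≤majorant′ N) (≤-trans (*-monoˡ (<⇒≤ (0<* (0<½* 0<δ) (0<r A))) h≤σ)
               (0≤-by 0≤1 (solve 1 (λ x → con 1ℚ := con 1ℚ :+ x :- x) refl (k * r A * σ j r)))) ⟩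
        c N * (1ℚ + k * r A * σ j r)
          ≤⟨ majorant-decay q A ∣q∣≤A δ 0<δ t δ≤ j ⟩
        c A
          ≤⟨ cA≤B ⟩
        B
          ≡⟨ trans (sym Dκε≡B) (*-comm D (k * ε)) ⟩
        k * ε * D ∎)
        where open ≤-Reasoning

  -- Bounded and null double sequences

  Eventually : (ℕ → Set) → Set
  Eventually P = ∃[ M ] (∀ m → m ℕ.≥ M → P m)

  both : ∀ {P Q R : ℕ → Set} → (∀ m → P m → Q m → R m) →
         Eventually P → Eventually Q → Eventually R
  both f (M , p) (N , q) = M ℕ.⊔ N , λ m m≥ →
    f m (p m (ℕ.m⊔n≤o⇒m≤o M N m≥)) (q m (ℕ.m⊔n≤o⇒n≤o M N m≥))

  map : ∀ {P Q : ℕ → Set} → (∀ m → P m → Q m) → Eventually P → Eventually Q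
  map f (M , p) = M , λ m m≥M → f m (p m m≥M)

  Bounded : (ℕ → ℚ) → Set
  Bounded u = ∃[ A ] (0ℚ < A) × Eventually (λ m → ∣ u m ∣ ≤ A)

  bounded-const : ∀ c → Bounded (λ _ → c)
  bounded-const c = 1ℚ + ∣ c ∣ , +-mono-<-≤ 0<1 (0≤∣p∣ c) , 0 , λ _ _ →
    0≤-by 0≤1 (solve 1 (λ x → con 1ℚ := con 1ℚ :+ x :- x) refl ∣ c ∣)

  bounded-+ : ∀ {u v} → Bounded u → Bounded v → Bounded (λ m → u m + v m)
  bounded-+ (A , 0<A , u≤A) (B , 0<B , v≤B) =
    A + B , +-mono-< 0<A 0<B , both (λ _ → ∣+∣≤) u≤A v≤B

  bounded-* : ∀ {u v} → Bounded u → Bounded v → Bounded (λ m → u m * v m)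
  bounded-* (A , 0<A , u≤A) (B , 0<B , v≤B) =
    A * B , 0<* 0<A 0<B , both (λ _ → ∣*∣≤ (<⇒≤ 0<A)) u≤A v≤B

  bounded-neg : ∀ {u} → Bounded u → Bounded (λ m → - u m)
  bounded-neg {u} (A , 0<A , u≤A) =
    A , 0<A , map (λ m → subst (_≤ A) (sym (∣-p∣≡∣p∣ (u m)))) u≤A

  bounded-σ : ∀ {D : ℕ → ℕ → ℚ} → (∀ i → Bounded (D i)) → ∀ n → Bounded (λ m → σ n (λ i → D i m))
  bounded-σ b zero    = bounded-const 0ℚ
  bounded-σ b (suc n) = bounded-+ (bounded-σ b n) (b n)

  bounded-coeff : ∀ {q} → Bounded q → ∀ i → Bounded (λ m → coeff (q m) i)
  bounded-coeff b zero    = bounded-const 1ℚ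
  bounded-coeff b (suc i) = bounded-* (bounded-coeff b i)
    (bounded-+ (bounded-const 1ℚ) (bounded-neg (bounded-* b (bounded-const (r i)))))

  bounded-partial : ∀ {q} → Bounded q → ∀ s n → Bounded (λ m → partial (q m) s n)
  bounded-partial b s = bounded-σ (λ i → bounded-* (bounded-coeff b i) (bounded-const (r i ^ s)))

  -- A double sequence D n m stands for a sequence of reals, m being the index
  -- of the Cauchy sequence; Null says that these reals tend to 0 as n → ∞.
  Null : (ℕ → ℕ → ℚ) → Set
  Null D = ∀ ε → 0ℚ < ε → Eventually (λ n → Eventually (λ m → ∣ D n m ∣ ≤ ε))

  null-+ : ∀ {D E} → Null D → Null E → Null (λ n m → D n m + E n m)
  null-+ {D} {E} d e ε 0<ε = both
    (λ n → both (λ m d≤ e≤ → subst (∣ D n m + E n m ∣ ≤_) (halves ε) (∣+∣≤ d≤ e≤)))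
    (d (½ * ε) (0<½* 0<ε)) (e (½ * ε) (0<½* 0<ε))

  null-≤ : ∀ {D E} → Eventually (λ m → ∀ n → ∣ E n m ∣ ≤ ∣ D n m ∣) → Null D → Null E
  null-≤ e≤d d ε 0<ε =
    map (λ n → both (λ m e≤d d≤ε → ≤-trans (e≤d n) d≤ε) e≤d) (d ε 0<ε)

  -- The threshold in m comes before n: identities involving reciprocals hold as soon as the m-th
  -- approximation is nonzero, for every n simultaneously.
  null-cong : ∀ {D E} → Eventually (λ m → ∀ n → D n m ≡ E n m) → Null D → Null E
  null-cong d≡e = null-≤ (map (λ m d≡e n → ≤-reflexive (cong ∣_∣ (sym (d≡e n)))) d≡e)

  always : {P : ℕ → Set} → (∀ m → P m) → Eventually P
  always p = 0 , λ m _ → p m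

  null-neg : ∀ {D} → Null D → Null (λ n m → - D n m)
  null-neg {D} = null-≤ (always λ m n → ≤-reflexive (∣-p∣≡∣p∣ (D n m)))

  null-* : ∀ {D u} → Bounded u → Null D → Null (λ n m → u m * D n m)
  null-* {D} {u} (A , 0<A , u≤A) d ε 0<ε =
    let δ , 0<δ , δA≡ε = divide 0<ε 0<A
    in map (λ n → both (λ m u≤ d≤ → subst (∣ u m * D n m ∣ ≤_) (trans (*-comm A δ) δA≡ε)
                          (∣*∣≤ (<⇒≤ 0<A) u≤ d≤)) u≤A) (d δ 0<δ)

  null-r : Null (λ n _ → r n)
  null-r ε 0<ε =
    let D , 0<D , Dε≡1 = divide 0<1 0<ε
        k , D≤k = archimedean D
    in k , λ n n≥k → always λ _ → subst₂ _≤_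
      (trans (cong (r n *_) Dε≡1) (trans (*-identityʳ (r n)) (sym (0≤p⇒∣p∣≡p (0≤r n)))))
      (trans (sym (*-assoc (r n) (nat (suc n)) ε))
        (trans (cong (_* ε) (r*nat n)) (*-identityˡ ε)))
      (*-monoˡ (0≤r n) (*-monoʳ (<⇒≤ 0<ε) (≤-trans D≤k (nat-mono (ℕ.m≤n⇒m≤1+n n≥k)))))

  -- Cesàro means and Kronecker's lemma

  nat*r≤1 : ∀ n → nat n * r n ≤ 1ℚ
  nat*r≤1 n = subst (nat n * r n ≤_) (trans (*-comm (nat (suc n)) (r n)) (r*nat n))
    (*-monoʳ (0≤r n) (nat-mono (ℕ.n≤1+n n)))

  -- The first N terms have a sum bounded by A, which r n makes small; the later ones are at most
  -- ε/2 each, and n r n ≤ 1.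
  cesàro : ∀ {D} → (∀ n → Bounded (D n)) → Null D → Null (λ n m → r n * σ n (λ k → D k m))
  cesàro {D} b d ε 0<ε =
    let N , d≤ = d (½ * ε) (0<½* 0<ε)
        A , 0<A , σ≤A = bounded-σ b N
        K , rA≤ = null-* (A , 0<A , always {λ _ → ∣ A ∣ ≤ A} (λ _ → ≤-reflexive (0≤p⇒∣p∣≡p (<⇒≤ 0<A))))
                    null-r (½ * ε) (0<½* 0<ε)
    in K ℕ.⊔ N , λ n n≥ → both (λ m → combine n m A)
         (rA≤ n (ℕ.m⊔n≤o⇒m≤o K N n≥))
         (subst (λ k → Eventually (λ m → ∣ σ k (λ i → D i m) ∣ ≤ A + nat k * (½ * ε)))
           (ℕ.m∸n+n≡m (ℕ.m⊔n≤o⇒n≤o K N n≥))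
           (grow N A d≤ (map (λ m σ≤A → ≤-trans σ≤A (0≤-by (0≤* (0≤nat N) (<⇒≤ (0<½* 0<ε)))
              (solve 2 (λ A x → x := A :+ x :- A) refl A (nat N * (½ * ε))))) σ≤A) (n ∸ N)))
    where
    -- Counting ε/2 for the first N terms too gives slack at the start but lets the invariant
    -- mention the full index instead of its excess over N.
    grow : ∀ N A → (∀ n → n ℕ.≥ N → Eventually (λ m → ∣ D n m ∣ ≤ ½ * ε)) →
           Eventually (λ m → ∣ σ N (λ i → D i m) ∣ ≤ A + nat N * (½ * ε)) → ∀ j →
           Eventually (λ m → ∣ σ (j ℕ.+ N) (λ i → D i m) ∣ ≤ A + nat (j ℕ.+ N) * (½ * ε))
    grow N A d≤ start zero    = start
    grow N A d≤ start (suc j) = both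
      (λ m σ≤ d≤ → subst (∣ σ (suc (j ℕ.+ N)) (λ i → D i m) ∣ ≤_)
        (trans (solve 3 (λ A k x → A :+ k :* x :+ x := A :+ (con 1ℚ :+ k) :* x) refl
                 A (nat (j ℕ.+ N)) (½ * ε))
          (cong (λ k → A + k * (½ * ε)) (sym (nat-suc (j ℕ.+ N)))))
        (∣+∣≤ σ≤ d≤))
      (grow N A d≤ start j) (d≤ (j ℕ.+ N) (ℕ.m≤n+m N j))
    combine : ∀ n m A → ∣ A * r n ∣ ≤ ½ * ε →
      ∣ σ n (λ i → D i m) ∣ ≤ A + nat n * (½ * ε) → ∣ r n * σ n (λ i → D i m) ∣ ≤ ε
    combine n m A Ar≤ σ≤ = begin
      ∣ r n * S ∣                        ≡⟨ trans (∣p*q∣≡∣p∣*∣q∣ (r n) S) (cong (_* ∣ S ∣) (0≤p⇒∣p∣≡p (0≤r n))) ⟩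
      r n * ∣ S ∣                        ≤⟨ *-monoˡ (0≤r n) σ≤ ⟩
      r n * (A + nat n * (½ * ε))        ≡⟨ solve 4 (λ a A k x → a :* (A :+ k :* x) := A :* a :+ k :* a :* x) refl
                                              (r n) A (nat n) (½ * ε) ⟩
      A * r n + nat n * r n * (½ * ε)    ≤⟨ +-mono-≤ (≤-trans (p≤∣p∣ (A * r n)) Ar≤)
                                              (*-monoʳ (<⇒≤ (0<½* 0<ε)) (nat*r≤1 n)) ⟩
      ½ * ε + 1ℚ * (½ * ε)               ≡⟨ cong (_+_ (½ * ε)) (*-identityˡ (½ * ε)) ⟩
      ½ * ε + ½ * ε                      ≡⟨ halves ε ⟩
      ε                                  ∎
      where
      open ≤-Reasoning
      S = σ n (λ i → D i m)

  σ-minus-const : ∀ n f c → σ n (λ k → f k - c) ≡ σ n f - nat n * c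
  σ-minus-const zero    f c = trans (solve 1 (λ c → con 0ℚ := con 0ℚ :- con 0ℚ :* c) refl c)
    (cong (λ k → 0ℚ - k * c) (sym nat-zero))
  σ-minus-const (suc n) f c = trans (cong (_+ (f n - c)) (σ-minus-const n f c))
    (trans (solve 4 (λ s k c x → s :- k :* c :+ (x :- c) := s :+ x :- (con 1ℚ :+ k) :* c) refl
             (σ n f) (nat n) c (f n))
      (cong (λ k → σ (suc n) f - k * c) (sym (nat-suc n))))

  -- By Abel summation Hₙ r n = n r n (Pₙ - z) - r n Σ (Pₖ - z), where P is the partial sum of order
  -- p+1. The first part is dominated by Pₙ - z, the second is a Cesàro mean.
  kronecker : ∀ {q z} → Bounded q → Bounded z → ∀ p →
    Null (λ n m → partial (q m) (suc p) n - z m) → Null (λ n m → partial (q m) p n * r n)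
  kronecker {q} {z} bq bz p d = null-cong
    (always λ m n → trans
      (cong (λ s → nat n * r n * (partial (q m) (suc p) n - z m) + - (r n * s))
        (σ-minus-const n (partial (q m) (suc p)) (z m)))
      (trans
        (solve 5 (λ k a P z S → k :* a :* (P :- z) :+ (:- (a :* (S :- k :* z))) := (k :* P :- S) :* a) refl
          (nat n) (r n) (partial (q m) (suc p) n) (z m) (σ n (partial (q m) (suc p))))
        (cong (_* r n) (sym (partial-abel (q m) p n)))))
    (null-+
      (null-≤ (always λ m n → subst (_≤ ∣ partial (q m) (suc p) n - z m ∣)
        (sym (∣p*q∣≡∣p∣*∣q∣ (nat n * r n) _))
        (subst (∣ nat n * r n ∣ * ∣ partial (q m) (suc p) n - z m ∣ ≤_)
          (*-identityˡ ∣ partial (q m) (suc p) n - z m ∣)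
          (*-monoʳ (0≤∣p∣ (partial (q m) (suc p) n - z m))
            (subst (_≤ 1ℚ) (sym (0≤p⇒∣p∣≡p (0≤* (0≤nat n) (0≤r n)))) (nat*r≤1 n))))) d)
      (null-neg (cesàro (λ n → bounded-+ (bounded-partial bq (suc p) n) (bounded-neg bz)) d)))

  -- Limits of the partial sums

  sum-k[k+1]-limit : ∀ {q z} → Bounded q → Bounded z → ∀ p →
    Null (λ n m → partial (q m) (suc p) n - z m) →
    Null (λ n m → σ n (λ i → partial (q m) p (suc i) * (r i * r (suc i))) - z m)
  sum-k[k+1]-limit {q} {z} bq bz p d = null-cong
    (always λ m n → trans
      (solve 3 (λ P z x → P :- z :+ (:- x) := P :- x :- z) refl
        (partial (q m) (suc p) n) (z m) (partial (q m) p n * r n))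
      (cong (_- z m) (sym (sum-k[k+1] (q m) p n))))
    (null-+ d (null-neg (kronecker bq bz p d)))

  -- Value of Σ coeff / (lᵖ⁺¹ (l + 1)), with w standing for 1 / (q + 1); from
  -- 1 / (lᵖ⁺¹ (l + 1)) = 1 / lᵖ⁺¹ - 1 / (lᵖ (l + 1)).
  alternating : (ℕ → ℚ) → (ℕ → ℕ → ℚ) → ℕ → ℕ → ℚ
  alternating w ζ zero    m = w m
  alternating w ζ (suc p) m = ζ (2 ℕ.+ p) m - alternating w ζ p m

  -- For T₁ the error is w (q Hₙ - 1)/(n+1), with H of order 1, so convergence at order 2 and
  -- `kronecker` suffice. Higher orders follow by the recursion `mixed-suc`.
  mixed-limit : ∀ {q w} {ζ : ℕ → ℕ → ℚ} → Bounded q → Bounded w → (∀ s → Bounded (ζ s)) →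
    Eventually (λ m → (q m + 1ℚ) * w m ≡ 1ℚ) → ∀ p →
    (∀ s → 2 ℕ.≤ s → s ℕ.≤ 2 ℕ.+ p → Null (λ n m → partial (q m) s n - ζ s m)) →
    Null (λ n m → mixed (q m) (suc p) n - alternating w ζ p m)
  mixed-limit {q} {w} {ζ} bq bw bζ inverse zero d = null-cong
    (map (λ m inv n → identity m n inv) inverse)
    (null-+ (null-* (bounded-neg bw) (null-cong (always λ _ n → sym (*-identityʳ (r n))) null-r))
      (null-* bq (null-* bw (kronecker bq (bζ 2) 1 (d 2 ℕ.≤-refl ℕ.≤-refl)))))
    where
    identity : ∀ m n → (q m + 1ℚ) * w m ≡ 1ℚ →
      - w m * (r n * 1ℚ) + q m * (w m * (partial (q m) 1 n * r n)) ≡ mixed (q m) 1 n - w m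
    identity m n inv = trans
      (solve 4 (λ w a q P → (:- w) :* (a :* con 1ℚ) :+ q :* (w :* (P :* a))
         := w :* (con 1ℚ :- (con 1ℚ :- q :* P) :* a) :- w) refl (w m) (r n) (q m) (partial (q m) 1 n))
      (trans (cong (λ c → w m * (1ℚ - c * r n) - w m) (sym (coeff-partial (q m) n)))
      (trans (cong (λ x → w m * x - w m) (sym (mixed-one (q m) n)))
      (trans (solve 3 (λ w T x → w :* (T :* x) :- w := T :* (x :* w) :- w) refl (w m) (mixed (q m) 1 n) (q m + 1ℚ))
        (cong (_- w m) (trans (cong (mixed (q m) 1 n *_) inv) (*-identityʳ (mixed (q m) 1 n)))))))
  mixed-limit {q} {w} {ζ} bq bw bζ inverse (suc p) d = null-cong
    (always λ m n → trans
      (solve 4 (λ P z T t → P :- z :+ (:- (T :- t)) := P :- T :- (z :- t)) refl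
        (partial (q m) (2 ℕ.+ p) n) (ζ (2 ℕ.+ p) m) (mixed (q m) (suc p) n) (alternating w ζ p m))
      (cong (_- alternating w ζ (suc p) m) (sym (mixed-suc (q m) (suc p) n))))
    (null-+ (d (2 ℕ.+ p) (ℕ.s≤s (ℕ.s≤s ℕ.z≤n)) (ℕ.n≤1+n _))
      (null-neg (mixed-limit bq bw bζ inverse p (λ s 2≤s s≤ → d s 2≤s (ℕ.m≤n⇒m≤1+n s≤)))))

  sum-k[k+2]-limit : ∀ {q z} {t : ℕ → ℚ} → Bounded q → Bounded z → ∀ p →
    Null (λ n m → partial (q m) (suc p) n - z m) → Null (λ n m → mixed (q m) p n - t m) →
    Null (λ n m → σ n (λ i → partial (q m) p (suc i) * (r i * r (2 ℕ.+ i))) - ½ * (z m + t m))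
  sum-k[k+2]-limit {q} {z} {t} bq bz p dz dt = null-cong
    (always λ m n → trans
      (solve 7 (λ P z M t H a b →
          con ½ :* ((P :- z) :+ ((M :- t) :+ (:- (H :* a :+ H :* b))))
          := con ½ :* (P :+ M :- H :* (a :+ b)) :- con ½ :* (z :+ t)) refl
        (partial (q m) (suc p) n) (z m) (mixed (q m) p n) (t m) (partial (q m) p n) (r n) (r (suc n)))
      (cong (_- ½ * (z m + t m)) (sym (sum-k[k+2] (q m) p n))))
    (null-* (bounded-const ½) (null-+ dz (null-+ {λ n m → mixed (q m) p n - t m} dt (null-neg (null-+ h
      -- The second boundary term Hₙ/(n+2) is dominated by the first, Hₙ/(n+1).
      (null-≤ (always λ m n → subst₂ _≤_
          (sym (∣p*q∣≡∣p∣*∣q∣ (partial (q m) p n) (r (suc n))))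
          (sym (∣p*q∣≡∣p∣*∣q∣ (partial (q m) p n) (r n)))
          (*-monoˡ (0≤∣p∣ (partial (q m) p n))
            (subst₂ _≤_ (sym (0≤p⇒∣p∣≡p (0≤r (suc n)))) (sym (0≤p⇒∣p∣≡p (0≤r n))) (r-step n)))) h))))))
    where
    h : Null (λ n m → partial (q m) p n * r n)
    h = kronecker bq bz p dz

-- Passage from rational estimates to Cauchy reals

open import Defs
open import Data.Nat.Base using (_≤_)
open Rational hiding (_^_)
open Rational using () renaming (_^_ to _^ℚ_)
open +-*-Solver

seq-bounded : ∀ x → Bounded (seq x)
seq-bounded x =
  let N , close = cauchy x 1ℚ 0<1
  in 1ℚ ℚ.+ ∣ seq x N ∣ , ℚ.+-mono-<-≤ 0<1 (ℚ.0≤∣p∣ (seq x N)) , N , λ n n≥N →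
    subst (ℚ._≤ 1ℚ ℚ.+ ∣ seq x N ∣)
      (cong ∣_∣ (solve 2 (λ a b → a :- b :+ b := a) refl (seq x n) (seq x N)))
      (∣+∣≤ (ℚ.<⇒≤ (close n N n≥N ℕ.≤-refl)) ℚ.≤-refl)

⟶⇒null : ∀ f z → f ⟶ z → Null (λ n m → seq (f n) m ℚ.- seq z m)
⟶⇒null f z f⟶z ε 0<ε = map
  (λ n ((η , 0<η , lower) , (θ , 0<θ , upper)) → both
    (λ m lo hi → ∣∣≤
      (0≤-by (0≤+ (ℚ.<⇒≤ 0<θ) (p≤q⇒0≤q-p (ℚ.<⇒≤ hi)))
        (solve 4 (λ θ f z e → θ :+ (z :+ e :- (f :+ θ)) := e :- (f :- z)) refl θ (seq (f n) m) (seq z m) ε))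
      (0≤-by (0≤+ (ℚ.<⇒≤ 0<η) (p≤q⇒0≤q-p (ℚ.<⇒≤ lo)))
        (solve 4 (λ η f z e → η :+ (f :- (z :- e :+ η)) := e :- (:- (f :- z))) refl η (seq (f n) m) (seq z m) ε)))
    lower upper)
  (f⟶z ε 0<ε)

null⇒⟶ : ∀ f z → Null (λ n m → seq (f n) m ℚ.- seq z m) → f ⟶ z
null⇒⟶ f z d ε 0<ε = map
  (λ n small →
    (η , 0<η , map (λ m ≤η → 0<-by
        (ℚ.+-mono-<-≤ (ℚ.+-mono-< 0<η 0<η) (p≤q⇒0≤q-p (ℚ.≤-trans (-p≤∣p∣ (seq (f n) m ℚ.- seq z m)) ≤η)))
        (solve 3 (λ e f z → let h = con ½ :* (con ½ :* e) in
             h :+ h :+ (h :- (:- (f :- z))) := f :- (z :- e :+ h)) refl ε (seq (f n) m) (seq z m))) small) ,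
    (η , 0<η , map (λ m ≤η → 0<-by
        (ℚ.+-mono-<-≤ (ℚ.+-mono-< 0<η 0<η) (p≤q⇒0≤q-p (ℚ.≤-trans (p≤∣p∣ (seq (f n) m ℚ.- seq z m)) ≤η)))
        (solve 3 (λ e f z → let h = con ½ :* (con ½ :* e) in
             h :+ h :+ (h :- (f :- z)) := z :+ e :- (f :+ h)) refl ε (seq (f n) m) (seq z m))) small))
  (d η 0<η)
  where
  -- Strict order of reals asks for a positive rational gap: if the error is at most ε/4, a gap of
  -- ε/4 fits with room to spare.
  η = ½ ℚ.* (½ ℚ.* ε)
  0<η : 0ℚ ℚ.< η
  0<η = 0<½* (0<½* 0<ε)
  0<-by : ∀ {p q d} → 0ℚ ℚ.< d → d ≡ q ℚ.- p → p ℚ.< q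
  0<-by {p} {q} 0<d d≡ = subst₂ ℚ._<_ (ℚ.+-identityˡ p)
    (trans (cong (ℚ._+ p) d≡) (solve 2 (λ p q → q :- p :+ p := q) refl p q))
    (ℚ.+-monoˡ-< p 0<d)

-- The limit is the diagonal n ↦ `seq (f n) n`. Because the threshold in m does not depend on n, the
-- tail estimate may be used at n = m.
complete : ∀ f →
  (∀ ε → 0ℚ ℚ.< ε → ∃[ N ] Eventually (λ m → ∀ n → n ℕ.≥ N →
    ∣ seq (f n) m ℚ.- seq (f N) m ∣ ℚ.≤ ε)) →
  ∃[ z ] f ⟶ z
complete f uniform = mkℝ (λ n → seq (f n) n) diagonal-cauchy , null⇒⟶ f (mkℝ _ diagonal-cauchy) near
  where
  diagonal-cauchy : IsCauchy (λ n → seq (f n) n)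
  diagonal-cauchy ε 0<ε =
    -- Two diagonal entries are compared through `f N`: ε/4 for each passage to `f N`, and ε/2 for
    -- the oscillation of `f N` itself.
    let η = ½ ℚ.* (½ ℚ.* ε)
        0<η = 0<½* (0<½* 0<ε)
        N , M , tail = uniform η 0<η
        K , close = cauchy (f N) (½ ℚ.* ε) (0<½* 0<ε)
    in M ℕ.⊔ N ℕ.⊔ K , λ m n m≥ n≥ →
      let m≥MN = ℕ.m⊔n≤o⇒m≤o (M ℕ.⊔ N) K m≥
          n≥MN = ℕ.m⊔n≤o⇒m≤o (M ℕ.⊔ N) K n≥
      in subst₂ ℚ._<_
        (cong ∣_∣ (solve 4 (λ a b c d → (b :- c) :+ ((a :- b) :- (d :- c)) := a :- d) refl
          (seq (f m) m) (seq (f N) m) (seq (f N) n) (seq (f n) n)))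
        (solve 1 (λ e → con ½ :* e :+ (con ½ :* (con ½ :* e) :+ con ½ :* (con ½ :* e)) := e) refl ε)
        (ℚ.≤-<-trans (ℚ.∣p+q∣≤∣p∣+∣q∣ (seq (f N) m ℚ.- seq (f N) n) _)
          (ℚ.+-mono-<-≤
            (close m n (ℕ.m⊔n≤o⇒n≤o (M ℕ.⊔ N) K m≥) (ℕ.m⊔n≤o⇒n≤o (M ℕ.⊔ N) K n≥))
            (ℚ.≤-trans (ℚ.∣p-q∣≤∣p∣+∣q∣ (seq (f m) m ℚ.- seq (f N) m) (seq (f n) n ℚ.- seq (f N) n))
              (ℚ.+-mono-≤
                (tail m (ℕ.m⊔n≤o⇒m≤o M N m≥MN) m (ℕ.m⊔n≤o⇒n≤o M N m≥MN))
                (tail n (ℕ.m⊔n≤o⇒m≤o M N n≥MN) n (ℕ.m⊔n≤o⇒n≤o M N n≥MN))))))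
  near : Null (λ n m → seq (f n) m ℚ.- seq (f m) m)
  near ε 0<ε =
    let N , M , tail = uniform (½ ℚ.* ε) (0<½* 0<ε)
    in N , λ n n≥N → M ℕ.⊔ N , λ m m≥ →
      let m≥M = ℕ.m⊔n≤o⇒m≤o M N m≥
      in subst₂ ℚ._≤_
        (cong ∣_∣ (solve 3 (λ a b c → (a :- b) :- (c :- b) := a :- c) refl
          (seq (f n) m) (seq (f N) m) (seq (f m) m)))
        (halves ε)
        (ℚ.≤-trans (ℚ.∣p-q∣≤∣p∣+∣q∣ (seq (f n) m ℚ.- seq (f N) m) (seq (f m) m ℚ.- seq (f N) m))
          (ℚ.+-mono-≤ (tail m m≥M n n≥N) (tail m m≥M m (ℕ.m⊔n≤o⇒n≤o M N m≥))))

-- `recip` takes the value 0 at 0, so identities with an inverse are available only from such an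
-- index on.
eventually-≢0 : ∀ x → x # 0ℝ → Eventually (λ m → seq x m ≢ 0ℚ)
eventually-≢0 x (inj₁ (ε , 0<ε , x<0)) = map (λ m x+ε<0 x≡0 → ℚ.<-asym 0<ε
  (subst (ℚ._< 0ℚ) (trans (cong (ℚ._+ ε) x≡0) (ℚ.+-identityˡ ε)) x+ε<0)) x<0
eventually-≢0 x (inj₂ (ε , 0<ε , 0<x)) = map (λ m 0+ε<x x≡0 → ℚ.<-asym 0<ε
  (subst₂ ℚ._<_ (ℚ.+-identityˡ ε) x≡0 0+ε<x)) 0<x

recip-inverseʳ : ∀ q → q ≢ 0ℚ → q ℚ.* recip q ≡ 1ℚ
recip-inverseʳ q q≢0 with q ℚ.≟ 0ℚ
... | yes q≡0 = contradiction q≡0 q≢0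
... | no  q≢0 = ℚ.*-inverseʳ q {{ℚ.≢-nonZero q≢0}}

-- Series terms as rational coefficients

seq-∑< : ∀ n f m → seq (∑< n f) m ≡ σ n (λ i → seq (f i) m)
seq-∑< zero    f m = refl
seq-∑< (suc n) f m = cong (ℚ._+ seq (f n) m) (seq-∑< n f m)

seq-∑ : ∀ n (f : (k : ℕ) → .{{NonZero k}} → ℝ) m →
  seq (∑[ 1 ⋯ n ] f) m ≡ σ n (λ i → seq (f (suc i)) m)
seq-∑ n f = seq-∑< n (λ i → f (suc i))

null⇒HasSum : ∀ f z (F : ℕ → ℕ → ℚ) (t : ℕ → ℚ) →
  Eventually (λ m → ∀ i → seq (f (suc i)) m ≡ F i m) → (∀ m → seq z m ≡ t m) →
  Null (λ n m → σ n (λ i → F i m) ℚ.- t m) → HasSum f z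
null⇒HasSum f z F t f≡F z≡t d = null⇒⟶ (λ n → ∑[ 1 ⋯ n ] f) z (null-cong
  {λ n m → σ n (λ i → F i m) ℚ.- t m}
  (map (λ m f≡F n → sym (cong₂ ℚ._-_ (trans (seq-∑ n f m) (σ-cong n f≡F)) (z≡t m))) f≡F) d)

HasSum⇒null : ∀ f z (F : ℕ → ℕ → ℚ) → Eventually (λ m → ∀ i → seq (f (suc i)) m ≡ F i m) →
  HasSum f z → Null (λ n m → σ n (λ i → F i m) ℚ.- seq z m)
HasSum⇒null f z F f≡F f-sum = null-cong
  {λ n m → seq (∑[ 1 ⋯ n ] f) m ℚ.- seq z m}
  (map (λ m f≡F n → cong (ℚ._- seq z m) (trans (seq-∑ n f m) (σ-cong n f≡F))) f≡F)
  (⟶⇒null (λ n → ∑[ 1 ⋯ n ] f) z f-sum)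

seq-^ : ∀ x n m → seq (x ^ n) m ≡ seq x m ^ℚ n
seq-^ x zero    m = refl
seq-^ x (suc n) m = cong (seq x m ℚ.*_) (seq-^ x n m)

-- Reconciles the two numerators: zeta terms carry separate powers of -1 and λ, harmonic terms a
-- power of -λ.
-1^*^ : ∀ q n → (ℚ.- 1ℚ) ^ℚ n ℚ.* q ^ℚ n ≡ (ℚ.- q) ^ℚ n
-1^*^ q zero    = refl
-1^*^ q (suc n) = trans
  (solve 3 (λ q x y → (:- con 1ℚ) :* x :* (q :* y) := (:- q) :* (x :* y)) refl q ((ℚ.- 1ℚ) ^ℚ n) (q ^ℚ n))
  (cong (ℚ._*_ (ℚ.- q)) (-1^*^ q n))

1/-suc* : ∀ c i → (+ 1 ℚ./ (suc i ℕ.* suc (c ℕ.+ i))) {{m*n≢0 (suc i) (suc (c ℕ.+ i))}}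
  ≡ r i ℚ.* r (c ℕ.+ i)
1/-suc* c i = trans (1/-* (suc i) (suc (c ℕ.+ i)) {{_}} {{_}} {{m*n≢0 (suc i) (suc (c ℕ.+ i))}})
  (cong₂ ℚ._*_ (sym (r-def i)) (sym (r-def (c ℕ.+ i))))

1/^ : ∀ i s .{{_ : NonZero (suc i ℕ.^ s)}} → + 1 ℚ./ (suc i ℕ.^ s) ≡ r i ^ℚ s
1/^ i zero    = refl
1/^ i (suc s) = trans (1/-* (suc i) (suc i ℕ.^ s) {{_}} {{ℕ.m^n≢0 (suc i) s}})
  (cong₂ ℚ._*_ (sym (r-def i)) (1/^ i s {{ℕ.m^n≢0 (suc i) s}}))

module _ (lam : ℝ) (lam#0 : lam # 0ℝ) where

  -- Passing from i to i+1 multiplies the left side by -q (1 - (i+1)/q)/(i+1) = 1 - q/(i+1), the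
  -- recursion of `coeff`; cancelling q against 1/q requires q ≠ 0.
  coeff-falling : ∀ m → seq lam m ≢ 0ℚ → ∀ i →
    (ℚ.- seq lam m) ^ℚ i ℚ.* seq (falling 1ℝ (suc i) (inv lam lam#0)) m ℚ.* (+ 1 ℚ./ i !) {{i ℕ.!≢0}}
      ≡ coeff (seq lam m) i
  coeff-falling m q≢0 zero    = cong (λ x → 1ℚ ℚ.* (1ℚ ℚ.* (1ℚ ℚ.- x)) ℚ.* 1ℚ) (ℚ.*-zeroˡ (recip (seq lam m)))
  coeff-falling m q≢0 (suc i) = trans
    (cong₂ (λ k f → (ℚ.- q) ^ℚ suc i ℚ.* (F ℚ.* (1ℚ ℚ.- k ℚ.* ρ)) ℚ.* f)
      (sym (nat-def (suc i)))
      (trans (1/-* (suc i) (i !) {{_}} {{i ℕ.!≢0}} {{suc i ℕ.!≢0}}) (cong (ℚ._* 1/i!) (sym (r-def i)))))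
    (trans
      (solve 7 (λ q x F k ρ a f →
          (:- q) :* x :* (F :* (con 1ℚ :- k :* ρ)) :* (a :* f)
          := x :* F :* f :* (q :* ρ :* (a :* k) :- q :* a)) refl
        q ((ℚ.- q) ^ℚ i) F (nat (suc i)) ρ (r i) 1/i!)
      (cong₂ ℚ._*_ (coeff-falling m q≢0 i)
        (cong (ℚ._- q ℚ.* r i) (cong₂ ℚ._*_ (recip-inverseʳ q q≢0) (r*nat i)))))
    where
    q = seq lam m
    ρ = recip q
    F = seq (falling 1ℝ (suc i) (inv lam lam#0)) m
    1/i! = (+ 1 ℚ./ i !) {{i ℕ.!≢0}}

  seq-ζ-term : ∀ s m → seq lam m ≢ 0ℚ → ∀ i →
    seq (ζ-term lam lam#0 s (suc i)) m ≡ coeff (seq lam m) i ℚ.* r i ^ℚ s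
  seq-ζ-term s m q≢0 i = trans
    (cong₂ (λ x y → x ℚ.* F ℚ.* y)
      (trans (cong₂ ℚ._*_ (seq-^ (- 1ℝ) i m) (seq-^ lam i m)) (-1^*^ q i))
      (trans (1/-* (i !) (suc i ℕ.^ s) {{i ℕ.!≢0}} {{ℕ.m^n≢0 (suc i) s}}
              {{m*n≢0 (i !) (suc i ℕ.^ s) {{i ℕ.!≢0}} {{ℕ.m^n≢0 (suc i) s}}}})
        (cong (ℚ._*_ 1/i!) (1/^ i s {{ℕ.m^n≢0 (suc i) s}}))))
    (trans (sym (ℚ.*-assoc ((ℚ.- q) ^ℚ i ℚ.* F) 1/i! (r i ^ℚ s)))
      (cong (ℚ._* r i ^ℚ s) (coeff-falling m q≢0 i)))
    where
    q = seq lam m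
    F = seq (falling 1ℝ (suc i) (inv lam lam#0)) m
    1/i! = (+ 1 ℚ./ i !) {{i ℕ.!≢0}}

  seq-H-term : ∀ s m → seq lam m ≢ 0ℚ → ∀ i →
    seq (H-term lam lam#0 s (suc i)) m ≡ coeff (seq lam m) i ℚ.* r i ^ℚ s
  seq-H-term s m q≢0 i = trans
    (cong₂ (λ x y → x ℚ.* F ℚ.* y)
      (seq-^ (- lam) i m)
      (trans (1/-* (suc i ℕ.^ s) (i !) {{ℕ.m^n≢0 (suc i) s}} {{i ℕ.!≢0}}
              {{m*n≢0 (suc i ℕ.^ s) (i !) {{ℕ.m^n≢0 (suc i) s}} {{i ℕ.!≢0}}}})
        (trans (cong (ℚ._* 1/i!) (1/^ i s {{ℕ.m^n≢0 (suc i) s}})) (ℚ.*-comm (r i ^ℚ s) 1/i!))))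
    (trans (sym (ℚ.*-assoc ((ℚ.- q) ^ℚ i ℚ.* F) 1/i! (r i ^ℚ s)))
      (cong (ℚ._* r i ^ℚ s) (coeff-falling m q≢0 i)))
    where
    q = seq lam m
    F = seq (falling 1ℝ (suc i) (inv lam lam#0)) m
    1/i! = (+ 1 ℚ./ i !) {{i ℕ.!≢0}}

  seq-ζ-partial : ∀ s m → seq lam m ≢ 0ℚ → ∀ n →
    seq (∑[ 1 ⋯ n ] (ζ-term lam lam#0 s)) m ≡ partial (seq lam m) s n
  seq-ζ-partial s m q≢0 n = trans (seq-∑ n (ζ-term lam lam#0 s) m) (σ-cong n (seq-ζ-term s m q≢0))

  seq-H : ∀ s m → seq lam m ≢ 0ℚ → ∀ n →
    seq (H lam lam#0 s n) m ≡ partial (seq lam m) s n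
  seq-H s m q≢0 n = trans (seq-∑ n (H-term lam lam#0 s) m) (σ-cong n (seq-H-term s m q≢0))

  zeta-null : ∀ s z → IsZeta lam lam#0 s z →
    Null (λ n m → partial (seq lam m) s n ℚ.- seq z m)
  zeta-null s z = HasSum⇒null (ζ-term lam lam#0 s) z (λ i m → coeff (seq lam m) i ℚ.* r i ^ℚ s)
    (map (λ m → seq-ζ-term s m) (eventually-≢0 lam lam#0))

  H/[k[1+k]] : ℕ → (k : ℕ) → .{{NonZero k}} → ℝ
  H/[k[1+k]] p k = (H lam lam#0 p k /ℕ (k ℕ.* suc k)) {{m*n≢0 k (suc k)}}

  H/[k[2+k]] : ℕ → (k : ℕ) → .{{NonZero k}} → ℝ
  H/[k[2+k]] p k = (H lam lam#0 p k /ℕ (k ℕ.* (2 ℕ.+ k))) {{m*n≢0 k (2 ℕ.+ k)}}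

  seq-H/[k[1+k]] : ∀ p m → seq lam m ≢ 0ℚ → ∀ i →
    seq (H/[k[1+k]] p (suc i)) m ≡ partial (seq lam m) p (suc i) ℚ.* (r i ℚ.* r (suc i))
  seq-H/[k[1+k]] p m q≢0 i = trans (product (suc i)) (cong₂ ℚ._*_ (seq-H p m q≢0 (suc i)) (1/-suc* 1 i))
    where
    product : ∀ k → .{{_ : NonZero k}} → seq (H/[k[1+k]] p k) m
      ≡ seq (H lam lam#0 p k) m ℚ.* (+ 1 ℚ./ (k ℕ.* suc k)) {{m*n≢0 k (suc k)}}
    product k = refl

  seq-H/[k[2+k]] : ∀ p m → seq lam m ≢ 0ℚ → ∀ i →
    seq (H/[k[2+k]] p (suc i)) m ≡ partial (seq lam m) p (suc i) ℚ.* (r i ℚ.* r (2 ℕ.+ i))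
  seq-H/[k[2+k]] p m q≢0 i = trans (product (suc i)) (cong₂ ℚ._*_ (seq-H p m q≢0 (suc i)) (1/-suc* 2 i))
    where
    product : ∀ k → .{{_ : NonZero k}} → seq (H/[k[2+k]] p k) m
      ≡ seq (H lam lam#0 p k) m ℚ.* (+ 1 ℚ./ (k ℕ.* (2 ℕ.+ k))) {{m*n≢0 k (2 ℕ.+ k)}}
    product k = refl

  k[1+k]-hasSum : ∀ p z → IsZeta lam lam#0 (suc p) z → HasSum (H/[k[1+k]] p) z
  k[1+k]-hasSum p z ζ≡z = null⇒HasSum (H/[k[1+k]] p) z
    (λ i m → partial (seq lam m) p (suc i) ℚ.* (r i ℚ.* r (suc i))) (seq z)
    (map (λ m → seq-H/[k[1+k]] p m) (eventually-≢0 lam lam#0)) (λ _ → refl)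
    (sum-k[k+1]-limit (seq-bounded lam) (seq-bounded z) p (zeta-null (suc p) z ζ≡z))

  k[2+k]-hasSum : ∀ p z (ζ : ℕ → ℝ) w →
    (∀ s → 2 ≤ s → s ≤ 2 ℕ.+ p → IsZeta lam lam#0 s (ζ s)) →
    Eventually (λ m → (seq lam m ℚ.+ 1ℚ) ℚ.* seq w m ≡ 1ℚ) →
    (∀ m → seq z m ≡ ½ ℚ.* (seq (ζ (2 ℕ.+ p)) m ℚ.+ alternating (seq w) (λ s → seq (ζ s)) p m)) →
    HasSum (H/[k[2+k]] (suc p)) z
  k[2+k]-hasSum p z ζ w ζ-sums inverse z≡ = null⇒HasSum (H/[k[2+k]] (suc p)) z
    (λ i m → partial (seq lam m) (suc p) (suc i) ℚ.* (r i ℚ.* r (2 ℕ.+ i)))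
    (λ m → ½ ℚ.* (seq (ζ (2 ℕ.+ p)) m ℚ.+ alternating (seq w) (λ s → seq (ζ s)) p m))
    (map (λ m → seq-H/[k[2+k]] (suc p) m) (eventually-≢0 lam lam#0)) z≡
    (sum-k[k+2]-limit (seq-bounded lam) (seq-bounded (ζ (2 ℕ.+ p))) (suc p)
      (zeta-limit (2 ℕ.+ p) (ℕ.s≤s (ℕ.s≤s ℕ.z≤n)) ℕ.≤-refl)
      (mixed-limit (seq-bounded lam) (seq-bounded w) (λ s → seq-bounded (ζ s)) inverse p zeta-limit))
    where
    zeta-limit : ∀ s → 2 ≤ s → s ≤ 2 ℕ.+ p → Null (λ n m → partial (seq lam m) s n ℚ.- seq (ζ s) m)
    zeta-limit s 2≤s s≤ = zeta-null s (ζ s) (ζ-sums s 2≤s s≤)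

  -- The hypothesis s + λ > 1 carries a rational gap δ, so s - 1 + q ≥ δ for every late
  -- approximation q of λ. With common bounds A for |q| and B for the initial majorant, `tail-bound`
  -- gives one N for all of them, as `complete` demands.
  zeta-converges : ∀ s → 2 ≤ s → 1ℝ < fromℕ s + lam → ∃[ z ] IsZeta lam lam#0 s z
  zeta-converges (suc zero)    (ℕ.s≤s ())
  zeta-converges (suc (suc t)) _ (δ , 0<δ , K , 1+δ<) =
    let C , _ , q≤C = seq-bounded lam
        A , C≤A = archimedean C
        B , 0<B , b≤B = bounded-* (bounded-coeff (seq-bounded lam) A) (bounded-const (r A ^ℚ suc t))
    in complete (λ n → ∑[ 1 ⋯ n ] (ζ-term lam lam#0 (suc (suc t)))) λ ε 0<ε →
      let N , tail = tail-bound A δ 0<δ (suc t) B 0<B ε 0<ε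
      in N , both (λ m q≢0 (q≤C , b≤B , 1+δ<) n n≥N →
          subst₂ (λ x y → ∣ x ℚ.- y ∣ ℚ.≤ ε)
            (sym (seq-ζ-partial (suc (suc t)) m q≢0 n)) (sym (seq-ζ-partial (suc (suc t)) m q≢0 N))
            (tail (seq lam m) (ℚ.≤-trans q≤C C≤A) (gap m 1+δ<)
              (subst (ℚ._≤ B) (trans (ℚ.∣p*q∣≡∣p∣*∣q∣ (coeff (seq lam m) A) (r A ^ℚ suc t))
                (cong (∣ coeff (seq lam m) A ∣ ℚ.*_) (ℚ.0≤p⇒∣p∣≡p (^-nonNeg (suc t) (0≤r A))))) b≤B)
              n n≥N))
        (eventually-≢0 lam lam#0)
        (both (λ _ → _,_) q≤C (both (λ _ → _,_) b≤B (K , 1+δ<)))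
    where
    gap : ∀ m → 1ℚ ℚ.+ δ ℚ.< + (suc (suc t)) ℚ./ 1 ℚ.+ seq lam m → δ ℚ.≤ nat (suc t) ℚ.+ seq lam m
    gap m lt = 0≤-by (p≤q⇒0≤q-p (ℚ.<⇒≤ lt)) (trans
      (cong (λ k → k ℚ.+ seq lam m ℚ.- (1ℚ ℚ.+ δ)) (trans (sym (nat-def (suc (suc t)))) (nat-suc (suc t))))
      (solve 3 (λ k q d → con 1ℚ :+ k :+ q :- (con 1ℚ :+ d) := k :+ q :- d) refl (nat (suc t)) (seq lam m) δ))

-- The closed form and the final statement

alternating-closed : ∀ (w : ℕ → ℚ) (ζ : ℕ → ℕ → ℚ) p m →
  σ p (λ i → (ℚ.- 1ℚ) ^ℚ i ℚ.* ζ (suc p ∸ i) m) ℚ.+ (ℚ.- 1ℚ) ^ℚ p ℚ.* w m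
    ≡ alternating w ζ p m
alternating-closed w ζ zero    m = solve 1 (λ w → con 0ℚ :+ con 1ℚ :* w := w) refl (w m)
-- The recursion adds a zeta value at the front and negates the rest, so the sum is split at its
-- head.
alternating-closed w ζ (suc p) m = trans
  (cong (ℚ._+ (ℚ.- 1ℚ) ^ℚ suc p ℚ.* w m) (trans (σ-head p _)
    (cong₂ ℚ._+_ (ℚ.*-identityˡ (ζ (2 ℕ.+ p) m))
      (trans (σ-cong p (λ i → solve 2 (λ x z → (:- con 1ℚ) :* x :* z := :- (x :* z)) refl
                ((ℚ.- 1ℚ) ^ℚ i) (ζ (suc p ∸ i) m)))
        (σ-neg p (λ i → (ℚ.- 1ℚ) ^ℚ i ℚ.* ζ (suc p ∸ i) m))))))
  (trans (solve 4 (λ z S x w → z :+ (:- S) :+ (:- con 1ℚ) :* x :* w := z :- (S :+ x :* w)) refl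
      (ζ (2 ℕ.+ p) m) (σ p (λ i → (ℚ.- 1ℚ) ^ℚ i ℚ.* ζ (suc p ∸ i) m)) ((ℚ.- 1ℚ) ^ℚ p) (w m))
    (cong (ℚ._-_ (ζ (2 ℕ.+ p) m)) (alternating-closed w ζ p m)))

-- With k = i + 2 the sign (-1)^k equals (-1)^i, and the argument of ζ in the sum becomes
-- `suc p ∸ i`, as in `alternating-closed`.
seq-alternating : ∀ (w : ℝ) (ζ : ℕ → ℝ) p m →
  seq (fromℚ ½ * (ζ (suc p ℕ.+ 1)
        + ∑[ 2 ⋯ suc p ] (λ k → (- 1ℝ) ^ k * ζ (suc p ℕ.+ 2 ∸ k))
        + (- 1ℝ) ^ (suc p ℕ.+ 1) * w)) m
    ≡ ½ ℚ.* (seq (ζ (2 ℕ.+ p)) m ℚ.+ alternating (seq w) (λ s → seq (ζ s)) p m)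
seq-alternating w ζ p m = cong (ℚ._*_ ½) (trans
  (cong₂ ℚ._+_
    (cong₂ ℚ._+_ (cong (λ s → seq (ζ s) m) (ℕ.+-comm (suc p) 1))
      (trans (seq-∑< p _ m) (σ-cong p (λ i → cong₂ ℚ._*_ (sign i)
        (cong (λ s → seq (ζ (s ∸ (2 ℕ.+ i))) m) (ℕ.+-comm (suc p) 2))))))
    (cong (ℚ._* seq w m) (trans (cong (λ k → seq ((- 1ℝ) ^ k) m) (ℕ.+-comm (suc p) 1)) (sign p))))
  (trans (ℚ.+-assoc (seq (ζ (2 ℕ.+ p)) m) _ _)
    (cong (ℚ._+_ (seq (ζ (2 ℕ.+ p)) m)) (alternating-closed (seq w) (λ s → seq (ζ s)) p m))))
  where
  sign : ∀ i → seq ((- 1ℝ) ^ (2 ℕ.+ i)) m ≡ (ℚ.- 1ℚ) ^ℚ i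
  sign i = trans (seq-^ (- 1ℝ) (2 ℕ.+ i) m)
    (solve 1 (λ x → (:- con 1ℚ) :* ((:- con 1ℚ) :* x) := x) refl ((ℚ.- 1ℚ) ^ℚ i))

module _ (lam : ℝ) (lam#0 : lam # 0ℝ) where

  IsZeta-resp : ∀ {s s′} z → s ≡ s′ → IsZeta lam lam#0 s z → IsZeta lam lam#0 s′ z
  IsZeta-resp z refl ζ≡z = ζ≡z

  ∑H/[k[1+k]]≡ζ : (p : ℕ) (z : ℝ) → IsZeta lam lam#0 (p ℕ.+ 1) z →
    HasSum (λ k → (H lam lam#0 p k /ℕ (k ℕ.* suc k)) {{m*n≢0 k (suc k)}}) z
  ∑H/[k[1+k]]≡ζ p z ζ≡z =
    k[1+k]-hasSum lam lam#0 p z (IsZeta-resp {p ℕ.+ 1} {suc p} z (ℕ.+-comm p 1) ζ≡z)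

  -- The sum is a variable z with an equation, since unfolding the formula
  -- during conversion checking is infeasible.
  ∑H/[k[2+k]]≡ : (p : ℕ) → 1 ≤ p → (ζ : ℕ → ℝ) →
    ((s : ℕ) → 2 ≤ s → s ≤ p ℕ.+ 1 → IsZeta lam lam#0 s (ζ s)) →
    (lam+1#0 : lam + 1ℝ # 0ℝ) → ∀ z →
    z ≡ fromℚ ½ *
      (ζ (p ℕ.+ 1)
        + ∑[ 2 ⋯ p ] (λ k → (- 1ℝ) ^ k * ζ (p ℕ.+ 2 ∸ k))
        + (- 1ℝ) ^ (p ℕ.+ 1) * inv (lam + 1ℝ) lam+1#0) →
    HasSum (H/[k[2+k]] lam lam#0 p) z
  ∑H/[k[2+k]]≡ (suc p) _ ζ ζ-sums lam+1#0 z z≡ =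
    k[2+k]-hasSum lam lam#0 p z ζ (inv (lam + 1ℝ) lam+1#0)
      (λ s 2≤s s≤ → ζ-sums s 2≤s (subst (s ≤_) (ℕ.+-comm 1 (suc p)) s≤))
      (map (λ m → recip-inverseʳ (seq lam m ℚ.+ 1ℚ)) (eventually-≢0 (lam + 1ℝ) lam+1#0))
      (λ m → trans (cong (λ x → seq x m) z≡) (seq-alternating (inv (lam + 1ℝ) lam+1#0) ζ p m))

theorem5 : (lam : ℝ) (lam#0 : lam # 0ℝ) →
    ((s : ℕ) → 2 ≤ s → 1ℝ < fromℕ s + lam → ∃[ z ] IsZeta lam lam#0 s z) ×
    ((p : ℕ) → 1 ≤ p →
    ((z : ℝ) → IsZeta lam lam#0 (p ℕ.+ 1) z →
    HasSum (λ k → (H lam lam#0 p k /ℕ (k ℕ.* suc k)) {{m*n≢0 k (suc k)}}) z) ×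
    ((ζ : ℕ → ℝ) →
    ((s : ℕ) → 2 ≤ s → s ≤ p ℕ.+ 1 → IsZeta lam lam#0 s (ζ s)) →
    (lam+1#0 : lam + 1ℝ # 0ℝ) →
    HasSum (λ k → (H lam lam#0 p k /ℕ (k ℕ.* (2 ℕ.+ k))) {{m*n≢0 k (2 ℕ.+ k)}})
    (fromℚ ½ *
    (ζ (p ℕ.+ 1)
    + ∑[ 2 ⋯ p ] (λ k → (- 1ℝ) ^ k * ζ (p ℕ.+ 2 ∸ k))
    + (- 1ℝ) ^ (p ℕ.+ 1) * inv (lam + 1ℝ) lam+1#0))))
theorem5 lam lam#0 =
  zeta-converges lam lam#0 , λ p 1≤p → ∑H/[k[1+k]]≡ζ lam lam#0 p ,
    λ ζ ζ-sums lam+1#0 →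
      let hasSum = ∑H/[k[2+k]]≡ lam lam#0 p 1≤p ζ ζ-sums lam+1#0 _ refl in hasSum
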